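{- For any computably bounded numbering $\phi$, the set $\mathrm{MIN}_\phi$ is not $(1,2)$-recursive.
   Context: A numbering $\phi$ is given by a partial-recursive function $U:\mathbb{N}^2\to\mathbb{N}$ via $\phi_e(x)=U(e,x)$. $\phi$ is computably bounded if for every numbering $\psi$ there is a computable $f$ such that for every $e$ some $j\le f(e)$ has $\phi_j=\psi_e$. $\mathrm{MIN}_\phi=\{e:(\forall j<e)\,[\phi_j\ne\phi_e]\}$. A set $A$ is $(1,2)$-recursive if there is a computable function $f$ mapping pairs to label vectors in $\{0,1\}^2$ such that for every pair $(x_1,x_2)$ the vectors $(\chi_A(x_1),\chi_A(x_2))$ and $f(x_1,x_2)$ agree in at least one position. -}

module Defs where

open import Data.Nat using (ℕ; zero; suc; _≤_; _<_)
open import Data.Fin using (Fin)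
open import Data.Vec using (Vec; []; _∷_; lookup)
open import Data.Product using (Σ; _×_; _,_; ∃)
open import Data.Sum using (_⊎_)
open import Relation.Nullary using (¬_)
open import Relation.Binary.PropositionalEquality using (_≡_)

data PR : ℕ → Set where
  zer  : ∀ {n} → PR n
  succ : PR 1
  proj : ∀ {n} → Fin n → PR n
  comp : ∀ {m n} → PR m → Vec (PR n) m → PR n
  prec : ∀ {n} → PR n → PR (suc (suc n)) → PR (suc n)
  mu   : ∀ {n} → PR (suc n) → PR n

data Eval : ∀ {n} → PR n → Vec ℕ n → ℕ → Set
data EvalVec : ∀ {m n} → Vec (PR n) m → Vec ℕ n → Vec ℕ m → Set

data Eval where
  ev-zer  : ∀ {n} {xs : Vec ℕ n} → Eval zer xs 0
  ev-succ : ∀ {x} → Eval succ (x ∷ []) (suc x)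
  ev-proj : ∀ {n} {i : Fin n} {xs} → Eval (proj i) xs (lookup xs i)
  ev-comp : ∀ {m n} {f : PR m} {gs : Vec (PR n) m} {xs ys y} →
            EvalVec gs xs ys → Eval f ys y → Eval (comp f gs) xs y
  ev-prec-z : ∀ {n} {g : PR n} {h : PR (suc (suc n))} {xs y} →
              Eval g xs y → Eval (prec g h) (0 ∷ xs) y
  ev-prec-s : ∀ {n} {g : PR n} {h : PR (suc (suc n))} {k xs r y} →
              Eval (prec g h) (k ∷ xs) r → Eval h (k ∷ r ∷ xs) y →
              Eval (prec g h) (suc k ∷ xs) y
  ev-mu   : ∀ {n} {f : PR (suc n)} {xs y} →
            Eval f (y ∷ xs) 0 →
            (∀ z → z < y → Σ ℕ λ k → Eval f (z ∷ xs) (suc k)) →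
            Eval (mu f) xs y

data EvalVec where
  ev-[] : ∀ {n} {xs : Vec ℕ n} → EvalVec [] xs []
  ev-∷  : ∀ {m n} {g : PR n} {gs : Vec (PR n) m} {xs y ys} →
          Eval g xs y → EvalVec gs xs ys → EvalVec (g ∷ gs) xs (y ∷ ys)

Computable₁ : (ℕ → ℕ) → Set
Computable₁ f = Σ (PR 1) λ p → ∀ x → Eval p (x ∷ []) (f x)

Computable₂ : (ℕ → ℕ → ℕ) → Set
Computable₂ f = Σ (PR 2) λ p → ∀ x y → Eval p (x ∷ y ∷ []) (f x y)

-- Numberings: a numbering is given by a partial recursive U : ℕ² ⇀ ℕ,
-- φ_e(x) = U(e, x).  We identify it with a program of arity 2.

Numbering : Set
Numbering = PR 2

SameFn : Numbering → ℕ → Numbering → ℕ → Set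
SameFn φ i ψ j = ∀ x y → (Eval φ (i ∷ x ∷ []) y → Eval ψ (j ∷ x ∷ []) y)
                       × (Eval ψ (j ∷ x ∷ []) y → Eval φ (i ∷ x ∷ []) y)

ComputablyBounded : Numbering → Set
ComputablyBounded φ =
  (ψ : Numbering) → Σ (ℕ → ℕ) λ f → Computable₁ f ×
    (∀ e → Σ ℕ λ j → j ≤ f e × SameFn φ j ψ e)

MIN : Numbering → ℕ → Set
MIN φ e = ∀ j → j < e → ¬ SameFn φ j φ e

AgreesWith : (ℕ → Set) → ℕ → ℕ → Set
AgreesWith A x b = (b ≡ 1 × A x) ⊎ (b ≡ 0 × ¬ A x)

-- f(x₁,x₂) = (f₁ x₁ x₂ , f₂ x₁ x₂) ∈ {0,1}², computable.
OneTwoRecursive : (ℕ → Set) → Set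
OneTwoRecursive A =
  Σ (ℕ → ℕ → ℕ) λ f₁ → Σ (ℕ → ℕ → ℕ) λ f₂ →
    Computable₂ f₁ × Computable₂ f₂ ×
    (∀ x₁ x₂ → f₁ x₁ x₂ ≤ 1 × f₂ x₁ x₂ ≤ 1) ×
    (∀ x₁ x₂ → AgreesWith A x₁ (f₁ x₁ x₂) ⊎ AgreesWith A x₂ (f₂ x₁ x₂))

{-# OPTIONS --safe #-}

-- A computably bounded φ is universal, so every partial recursive function of ⟨⟨a,b⟩,q⟩ is φ_a for some a, and
-- ψ_⟨a,b⟩(q) = φ_a(⟨⟨a,b⟩,q⟩) allows self-reference.  The bound for ψ then tells self-referential programs
-- numbers h₁, h₂, h₃, h₄ below which their own φ-indices lie.
--
-- Suppose (b₁, b₂) witnesses that MIN is (1,2)-recursive.  The least n > h₃ such that φ_0(0), …, φ_n(0) exhaust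
-- 0, …, h₃+1 is in MIN; it is approximated by a decreasing x.  A finite function A grows in stages, and the least
-- z ≤ h₂ such that φ_z extends A is in MIN as well.  If z ≤ h₁, then A changes its value at its newest argument,
-- which makes z incompatible with A for ever and so happens at most h₁+1 times.  If z > h₁, then
-- (b₁ z x, b₂ z x) excludes one possibility for z and x, and the construction enforces it:
--   * z, x ∈ MIN: this is the situation in the limit.
--   * z ∉ MIN, x ∈ MIN: a function K with index ≤ h₁ copies φ_z until x changes; afterwards A restarts as K
--     together with one new argument.
--   * z ∈ MIN, x ∉ MIN: a function reserved for z, with index ≤ h₃, copies φ_x, so that z is not in MIN either.
--   * z, x ∉ MIN: φ_z and φ_x are both copied for ever.
-- There are only finitely many changes, and every final state is contradictory.

module Submission where

open import Defs
open import Data.Nat using (ℕ; zero; suc; pred; _+_; _*_; _∸_; _⊔_; _≤_; _<_; z≤n; s≤s; _≟_; _≤?_; _<?_)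
open import Data.Nat.Properties
open import Data.Fin using (Fin; zero; suc; toℕ; fromℕ<)
open import Data.Fin.Properties using (pigeonhole; toℕ-fromℕ<; toℕ<n)
open import Data.Vec using (Vec; []; _∷_; lookup; map; head; tail; allFin)
open import Data.Vec.Properties using (map-∘; map-cong; map-lookup-allFin)
open import Data.Product using (Σ; ∃; _×_; _,_; proj₁; proj₂)
open import Data.Sum using (_⊎_; inj₁; inj₂)
open import Data.Empty using (⊥; ⊥-elim)
open import Relation.Nullary using (¬_; yes; no; contradiction)
open import Relation.Binary.PropositionalEquality

-- Definition by cases, bounded search and numerical truth values

case0 : ℕ → ℕ → ℕ → ℕ
case0 zero    a b = a
case0 (suc _) a b = b

rec : ℕ → (ℕ → ℕ → ℕ) → ℕ → ℕ
rec a f zero    = a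
rec a f (suc k) = f k (rec a f k)

-- The least k ≤ n with P k ≢ 0, and n if there is none.
bmin : ℕ → (ℕ → ℕ) → ℕ
bmin n P = rec 0 (λ k r → case0 (P r) (suc k) r) n

any≤ : ℕ → (ℕ → ℕ) → ℕ
any≤ n P = P (bmin n P)

not : ℕ → ℕ
not a = case0 a 1 0

all≤ : ℕ → (ℕ → ℕ) → ℕ
all≤ n P = not (any≤ n (λ k → not (P k)))

sum≤ : ℕ → (ℕ → ℕ) → ℕ
sum≤ n f = rec (f 0) (λ k r → r + f (suc k)) n

neq : ℕ → ℕ → ℕ
neq a b = (a ∸ b) + (b ∸ a)

same : ℕ → ℕ → ℕ
same a b = not (neq a b)

case0-≢0 : ∀ {n a b} → n ≢ 0 → case0 n a b ≡ b
case0-≢0 {zero}  n≢0 = contradiction refl n≢0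
case0-≢0 {suc n} _   = refl

case0-≡0 : ∀ {n a b} → n ≡ 0 → case0 n a b ≡ a
case0-≡0 refl = refl

suc≢0 : ∀ {n} → suc n ≢ 0
suc≢0 ()

≡suc⇒≢0 : ∀ {n k} → n ≡ suc k → n ≢ 0
≡suc⇒≢0 refl ()

≢0⇒≡suc : ∀ {n} → n ≢ 0 → n ≡ suc (pred n)
≢0⇒≡suc {zero}  n≢0 = contradiction refl n≢0
≢0⇒≡suc {suc n} _   = refl

not-≢0 : ∀ {n} → n ≡ 0 → not n ≢ 0
not-≢0 refl ()

not-≡0 : ∀ {n} → n ≢ 0 → not n ≡ 0
not-≡0 = case0-≢0

not-≢0⁻¹ : ∀ {n} → not n ≢ 0 → n ≡ 0
not-≢0⁻¹ {zero}  _ = refl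
not-≢0⁻¹ {suc n} h = contradiction refl h

not-≡0⁻¹ : ∀ {n} → not n ≡ 0 → n ≢ 0
not-≡0⁻¹ {zero}  ()
not-≡0⁻¹ {suc n} _ ()

neq-refl : ∀ a → neq a a ≡ 0
neq-refl a = cong₂ _+_ (n∸n≡0 a) (n∸n≡0 a)

neq-≡0 : ∀ a b → neq a b ≡ 0 → a ≡ b
neq-≡0 a b h = ≤-antisym (m∸n≡0⇒m≤n (m+n≡0⇒m≡0 (a ∸ b) h)) (m∸n≡0⇒m≤n (m+n≡0⇒n≡0 (a ∸ b) h))

neq-≢0 : ∀ {a b} → a ≢ b → neq a b ≢ 0
neq-≢0 {a} {b} a≢b h = a≢b (neq-≡0 a b h)

same-intro : ∀ {a b} → a ≡ b → same a b ≢ 0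
same-intro {a} refl = not-≢0 (neq-refl a)

same-elim : ∀ {a b} → same a b ≢ 0 → a ≡ b
same-elim {a} {b} h = neq-≡0 a b (not-≢0⁻¹ h)

bmin-≤ : ∀ n P → bmin n P ≤ n
bmin-≤ zero    P = z≤n
bmin-≤ (suc n) P with P (bmin n P)
... | zero  = ≤-refl
... | suc _ = m≤n⇒m≤1+n (bmin-≤ n P)

bmin-≡0 : ∀ n P → P (bmin n P) ≡ 0 → bmin n P ≡ n
bmin-≡0 zero    P h = refl
bmin-≡0 (suc n) P h with P (bmin n P) in eq
... | zero  = refl
... | suc _ = contradiction (trans (sym eq) h) (λ ())

bmin-least : ∀ n P {k} → k ≤ n → P k ≢ 0 → P (bmin n P) ≢ 0 × bmin n P ≤ k
bmin-least zero    P {zero} z≤n Pk = Pk , z≤n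
bmin-least (suc n) P {k} k≤ Pk with P (bmin n P) in eq
... | suc _ = (λ h → contradiction (trans (sym eq) h) (λ ())) , bound (m≤n⇒m<n∨m≡n k≤)
  where
  bound : k < suc n ⊎ k ≡ suc n → bmin n P ≤ k
  bound (inj₁ (s≤s k≤n)) = proj₂ (bmin-least n P k≤n Pk)
  bound (inj₂ refl)      = m≤n⇒m≤1+n (bmin-≤ n P)
... | zero with m≤n⇒m<n∨m≡n k≤
...   | inj₁ (s≤s k≤n) = contradiction eq (proj₁ (bmin-least n P k≤n Pk))
...   | inj₂ refl      = Pk , ≤-refl

bmin-< : ∀ n P {k} → k < bmin n P → P k ≡ 0
bmin-< n P {k} k< with P k ≟ 0
... | yes Pk = Pk
... | no  Pk = contradiction (proj₂ (bmin-least n P (≤-trans (<⇒≤ k<) (bmin-≤ n P)) Pk)) (<⇒≱ k<)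

-- A search for P that fails returns its bound n, the largest possible value, so the inequality
-- holds in that case too.
bmin-antitone : ∀ n P Q → (∀ k → P k ≢ 0 → Q k ≢ 0) → bmin n Q ≤ bmin n P
bmin-antitone n P Q P⇒Q with P (bmin n P) ≟ 0
... | yes h = ≤-trans (bmin-≤ n Q) (≤-reflexive (sym (bmin-≡0 n P h)))
... | no  h = proj₂ (bmin-least n Q (bmin-≤ n P) (P⇒Q _ h))

-- Once a witness is found, the bound no longer influences the result. So the first success, on
-- which `T` and `Copy` rely, stays the same at all later stages.
bmin-unique : ∀ n n′ P → P (bmin n P) ≢ 0 → P (bmin n′ P) ≢ 0 → bmin n P ≡ bmin n′ P
bmin-unique n n′ P h h′ = ≤-antisym (below n n′ h h′) (below n′ n h′ h)
  where
  below : ∀ n n′ → P (bmin n P) ≢ 0 → P (bmin n′ P) ≢ 0 → bmin n P ≤ bmin n′ P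
  below n n′ h h′ with ≤-total (bmin n′ P) n
  ... | inj₁ le = proj₂ (bmin-least n P le h′)
  ... | inj₂ le = ≤-trans (bmin-≤ n P) le

any-intro : ∀ n P {k} → k ≤ n → P k ≢ 0 → any≤ n P ≢ 0
any-intro n P k≤n Pk = proj₁ (bmin-least n P k≤n Pk)

any-elim : ∀ n P → any≤ n P ≢ 0 → ∃ λ k → k ≤ n × P k ≢ 0
any-elim n P h = bmin n P , bmin-≤ n P , h

all-intro : ∀ n P → (∀ k → k ≤ n → P k ≢ 0) → all≤ n P ≢ 0
all-intro n P h = not-≢0 (not-≡0 (h _ (bmin-≤ n _)))

all-elim : ∀ n P → all≤ n P ≢ 0 → ∀ k → k ≤ n → P k ≢ 0
all-elim n P h k k≤n Pk = any-intro n (λ k → not (P k)) k≤n (not-≢0 Pk) (not-≢0⁻¹ h)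

all-≡0 : ∀ n P → all≤ n P ≡ 0 → ∃ λ k → k ≤ n × P k ≡ 0
all-≡0 n P h = bmin n _ , bmin-≤ n _ , not-≢0⁻¹ (not-≡0⁻¹ h)

≤-sum : ∀ n f {i} → i ≤ n → f i ≤ sum≤ n f
≤-sum zero    f z≤n = ≤-refl
≤-sum (suc n) f i≤ with m≤n⇒m<n∨m≡n i≤
... | inj₁ (s≤s i≤n) = ≤-trans (≤-sum n f i≤n) (m≤m+n _ _)
... | inj₂ refl      = m≤n+m _ (sum≤ n f)

-- Total recursive functions

record Fun (n : ℕ) : Set where
  constructor fun
  field
    fn   : Vec ℕ n → ℕ
    prog : PR n
    ok   : ∀ xs → Eval prog xs (fn xs)
open Fun

progs : ∀ {m n} → Vec (Fun n) m → Vec (PR n) m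
progs = map prog

oks : ∀ {m n} (Gs : Vec (Fun n) m) xs → EvalVec (progs Gs) xs (map (λ G → fn G xs) Gs)
oks []       xs = ev-[]
oks (G ∷ Gs) xs = ev-∷ (ok G xs) (oks Gs xs)

app : ∀ {m n} → Fun m → Vec (Fun n) m → Fun n
app F Gs = fun (λ xs → fn F (map (λ G → fn G xs) Gs)) (comp (prog F) (progs Gs))
               (λ xs → ev-comp (oks Gs xs) (ok F _))

-- Exchanges the computed function for a pointwise equal expression, so that later equations between
-- `fn` and the intended function hold by `refl`.
cast : ∀ {n} (F : Fun n) (f : Vec ℕ n → ℕ) → (∀ xs → fn F xs ≡ f xs) → Fun n
cast F f eq = fun f (prog F) (λ xs → subst (Eval (prog F) xs) (eq xs) (ok F xs))

var : ∀ {n} → Fin n → Fun n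
var i = fun (λ xs → lookup xs i) (proj i) (λ _ → ev-proj)

v0 : ∀ {n} → Fun (1 + n)
v0 = var zero
v1 : ∀ {n} → Fun (2 + n)
v1 = var (suc zero)
v2 : ∀ {n} → Fun (3 + n)
v2 = var (suc (suc zero))
v3 : ∀ {n} → Fun (4 + n)
v3 = var (suc (suc (suc zero)))
v4 : ∀ {n} → Fun (5 + n)
v4 = var (suc (suc (suc (suc zero))))

vars : ∀ {n} → Vec (Fun n) n
vars {n} = map var (allFin n)

map-vars : ∀ {n} (xs : Vec ℕ n) → map (λ G → fn G xs) vars ≡ xs
map-vars xs = trans (sym (map-∘ _ _ _)) (map-lookup-allFin xs)

map-wk : ∀ {m n} (f : Fin m → Fin n) (xs : Vec ℕ m) (ys : Vec ℕ n) → (∀ i → lookup ys (f i) ≡ lookup xs i) →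
         map (λ G → fn G ys) (map (λ i → var (f i)) (allFin m)) ≡ xs
map-wk {m} f xs ys h = trans (sym (map-∘ _ _ _)) (trans (map-cong h (allFin m)) (map-lookup-allFin xs))

zeroF : ∀ {n} → Fun n
zeroF = fun (λ _ → 0) zer (λ _ → ev-zer)

sucF : ∀ {n} → Fun n → Fun n
sucF G = fun (λ xs → suc (fn G xs)) (comp succ (prog G ∷ []))
             (λ xs → ev-comp (ev-∷ (ok G xs) ev-[]) ev-succ)

conF : ∀ {n} → ℕ → Fun n
conF zero    = zeroF
conF (suc k) = sucF (conF k)

recF : ∀ {n} → Fun n → Fun (2 + n) → Fun (suc n)
recF G H = fun (λ xs → rec (fn G (tail xs)) (λ k r → fn H (k ∷ r ∷ tail xs)) (head xs))
               (prec (prog G) (prog H)) (λ { (k ∷ xs) → go k xs })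
  where
  go : ∀ k xs → Eval (prec (prog G) (prog H)) (k ∷ xs) (rec (fn G xs) (λ k r → fn H (k ∷ r ∷ xs)) k)
  go zero    xs = ev-prec-z (ok G xs)
  go (suc k) xs = ev-prec-s (go k xs) (ok H _)

Computable₃ : (ℕ → ℕ → ℕ → ℕ) → Set
Computable₃ f = Σ (PR 3) λ p → ∀ x y z → Eval p (x ∷ y ∷ z ∷ []) (f x y z)

to₁ : ∀ {f} (F : Fun 1) → (∀ x → fn F (x ∷ []) ≡ f x) → Computable₁ f
to₁ F h = prog F , λ x → subst (Eval (prog F) _) (h x) (ok F _)

to₂ : ∀ {f} (F : Fun 2) → (∀ x y → fn F (x ∷ y ∷ []) ≡ f x y) → Computable₂ f
to₂ F h = prog F , λ x y → subst (Eval (prog F) _) (h x y) (ok F _)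

to₃ : ∀ {f} (F : Fun 3) → (∀ x y z → fn F (x ∷ y ∷ z ∷ []) ≡ f x y z) → Computable₃ f
to₃ F h = prog F , λ x y z → subst (Eval (prog F) _) (h x y z) (ok F _)

app₁ : ∀ {n f} → Computable₁ f → Fun n → Fun n
app₁ {f = f} (p , e) X = fun (λ xs → f (fn X xs)) (comp p (prog X ∷ []))
  (λ xs → ev-comp (ev-∷ (ok X xs) ev-[]) (e _))

app₂ : ∀ {n f} → Computable₂ f → Fun n → Fun n → Fun n
app₂ {f = f} (p , e) X Y = fun (λ xs → f (fn X xs) (fn Y xs)) (comp p (prog X ∷ prog Y ∷ []))
  (λ xs → ev-comp (ev-∷ (ok X xs) (ev-∷ (ok Y xs) ev-[])) (e _ _))

app₃ : ∀ {n f} → Computable₃ f → Fun n → Fun n → Fun n → Fun n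
app₃ {f = f} (p , e) X Y Z = fun (λ xs → f (fn X xs) (fn Y xs) (fn Z xs)) (comp p (prog X ∷ prog Y ∷ prog Z ∷ []))
  (λ xs → ev-comp (ev-∷ (ok X xs) (ev-∷ (ok Y xs) (ev-∷ (ok Z xs) ev-[]))) (e _ _ _))

case0-c : Computable₃ case0
-- Recursion that ignores the recursive value; its step sees k, r, y, z, so `v3` is z.
case0-c = to₃ (recF v0 v3) λ { zero y z → refl ; (suc x) y z → refl }

+-c : Computable₂ _+_
+-c = to₂ (recF v0 (sucF v1)) go
  where
  go : ∀ x y → rec y (λ k r → suc r) x ≡ x + y
  go zero    y = refl
  go (suc x) y = cong suc (go x y)

*-c : Computable₂ _*_
*-c = to₂ (recF zeroF (app₂ +-c v2 v1)) go
  where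
  go : ∀ x y → rec 0 (λ k r → y + r) x ≡ x * y
  go zero    y = refl
  go (suc x) y = cong (y +_) (go x y)

pred-c : Computable₁ pred
pred-c = to₁ (recF zeroF v0) λ { zero → refl ; (suc x) → refl }

∸-c : Computable₂ _∸_
∸-c = to₂ (app (recF v0 (app₁ pred-c v1)) (v1 ∷ v0 ∷ [])) go
  where
  go : ∀ x y → rec x (λ k r → pred r) y ≡ x ∸ y
  go x zero    = refl
  go x (suc y) = trans (cong pred (go x y)) (pred[m∸n]≡m∸[1+n] x y)

not-c : Computable₁ not
not-c = to₁ (app₃ case0-c v0 (conF 1) zeroF) (λ _ → refl)

neq-c : Computable₂ neq
neq-c = to₂ (app₂ +-c (app₂ ∸-c v0 v1) (app₂ ∸-c v1 v0)) (λ _ _ → refl)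

same-c : Computable₂ same
same-c = to₂ (app₁ not-c (app₂ neq-c v0 v1)) (λ _ _ → refl)

instF : ∀ {n} → Fun (suc n) → Fun n → Fun n
instF B N = cast (app B (N ∷ vars)) (λ xs → fn B (fn N xs ∷ xs))
  (λ xs → cong (λ ys → fn B (fn N xs ∷ ys)) (map-vars xs))

bminF : ∀ {n} → Fun n → Fun (suc n) → Fun n
bminF {n} N B = instF (recF zeroF (app₃ case0-c B′ (sucF v0) v1)) N
  where
  -- The recursion step sees the counter, the candidate and `xs`; the test concerns the candidate,
  -- so the counter is dropped.
  B′ : Fun (2 + n)
  B′ = cast (app B (v1 ∷ map (λ i → var (suc (suc i))) (allFin n)))
            (λ { (k ∷ r ∷ xs) → fn B (r ∷ xs) })
            (λ { (k ∷ r ∷ xs) → cong (λ ys → fn B (r ∷ ys))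
                                     (map-wk (λ i → suc (suc i)) xs (k ∷ r ∷ xs) (λ _ → refl)) })

anyF : ∀ {n} → Fun n → Fun (suc n) → Fun n
anyF N B = instF B (bminF N B)

allF : ∀ {n} → Fun n → Fun (suc n) → Fun n
allF N B = app₁ not-c (anyF N (app₁ not-c B))

sumF : ∀ {n} → Fun n → Fun (suc n) → Fun n
sumF {n} N B = instF (recF (instF B zeroF) (app₂ +-c v1 B′)) N
  where
  B′ : Fun (2 + n)
  B′ = cast (app B (sucF v0 ∷ map (λ i → var (suc (suc i))) (allFin n)))
            (λ { (k ∷ r ∷ xs) → fn B (suc k ∷ xs) })
            (λ { (k ∷ r ∷ xs) → cong (λ ys → fn B (suc k ∷ ys))
                                     (map-wk (λ i → suc (suc i)) xs (k ∷ r ∷ xs) (λ _ → refl)) })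

-- Pairing

abstract
  -- The integer square root reads off x + y from (x + y)² + x.
  pair : ℕ → ℕ → ℕ
  pair x y = (x + y) * (x + y) + x

  sqrt : ℕ → ℕ
  sqrt = rec 0 (λ n r → case0 (suc r * suc r ∸ suc n) (suc r) r)

  fst : ℕ → ℕ
  fst n = n ∸ sqrt n * sqrt n

  snd : ℕ → ℕ
  snd n = sqrt n ∸ fst n

  sqrt-spec : ∀ n → sqrt n * sqrt n ≤ n × n < suc (sqrt n) * suc (sqrt n)
  sqrt-spec zero = z≤n , s≤s z≤n
  sqrt-spec (suc n) with sqrt-spec n | suc (sqrt n) * suc (sqrt n) ∸ suc n in eq
  ... | lo , hi | zero  = m∸n≡0⇒m≤n eq ,
    ≤-trans (s≤s hi) (*-mono-< (n<1+n (suc (sqrt n))) (n<1+n (suc (sqrt n))))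
  ... | lo , hi | suc k = m≤n⇒m≤1+n lo , m∸n≢0⇒n<m (λ h → contradiction (trans (sym eq) h) λ ())

  sqrt-unique : ∀ r n → r * r ≤ n → n < suc r * suc r → sqrt n ≡ r
  sqrt-unique r n lo hi = ≤-antisym (≤-pred (half (≤-<-trans (proj₁ (sqrt-spec n)) hi)))
                                    (≤-pred (half (≤-<-trans lo (proj₂ (sqrt-spec n)))))
    where
    half : ∀ {a b} → a * a < b * b → a < b
    half {a} {b} h with a <? b
    ... | yes a<b = a<b
    ... | no  a≮b = contradiction (*-mono-≤ (≮⇒≥ a≮b) (≮⇒≥ a≮b)) (<⇒≱ h)

  sqrt-pair : ∀ x y → sqrt (pair x y) ≡ x + y
  sqrt-pair x y = sqrt-unique r (pair x y) (m≤m+n _ _)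
    -- (r + 1)² unfolds to 1 + (r + r(r + 1)), which exceeds r² + x because x ≤ r.
    (s≤s (≤-trans (≤-reflexive (+-comm (r * r) x))
         (≤-trans (+-monoˡ-≤ (r * r) (m≤m+n x y)) (≤-trans (+-monoʳ-≤ r (*-monoʳ-≤ r (n≤1+n r))) ≤-refl))))
    where
    r : ℕ
    r = x + y

  fst-pair : ∀ x y → fst (pair x y) ≡ x
  fst-pair x y rewrite sqrt-pair x y = m+n∸m≡n ((x + y) * (x + y)) x

  snd-pair : ∀ x y → snd (pair x y) ≡ y
  snd-pair x y rewrite fst-pair x y | sqrt-pair x y = m+n∸m≡n x y

  pair-c : Computable₂ pair
  pair-c = to₂ (app₂ +-c (app₂ *-c (app₂ +-c v0 v1) (app₂ +-c v0 v1)) v0) (λ _ _ → refl)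

  sqrt-c : Computable₁ sqrt
  sqrt-c = to₁ (recF zeroF (app₃ case0-c (app₂ ∸-c (app₂ *-c (sucF v1) (sucF v1)) (sucF v0)) (sucF v1) v1)) (λ _ → refl)

  fst-c : Computable₁ fst
  fst-c = to₁ (app₂ ∸-c v0 (app₂ *-c (app₁ sqrt-c v0) (app₁ sqrt-c v0))) (λ _ → refl)

  snd-c : Computable₁ snd
  snd-c = to₁ (app₂ ∸-c (app₁ sqrt-c v0) (app₁ fst-c v0)) (λ _ → refl)

-- Evaluation with fuel

-- The value 0 means "no result yet" and suc v means "result v"; the fuel only bounds the searches of mu.
ap  : ∀ {n} → PR n → ℕ → Vec ℕ n → ℕ
aps : ∀ {m n} → Vec (PR n) m → ℕ → Vec ℕ n → Vec ℕ m

defined : ∀ {m} → Vec ℕ m → ℕ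
defined []       = 1
defined (v ∷ vs) = case0 v 0 (defined vs)

ap zer         s xs       = 1
ap succ        s (x ∷ []) = suc (suc x)
ap (proj i)    s xs       = suc (lookup xs i)
ap (comp f gs) s xs       = case0 (defined (aps gs s xs)) 0 (ap f s (map pred (aps gs s xs)))
ap (prec g h)  s (k ∷ xs) = rec (ap g s xs) (λ k r → case0 r 0 (ap h s (k ∷ pred r ∷ xs))) k
ap (mu f)      s xs       = case0 (same (ap f s (y ∷ xs)) 1) 0 (suc y)
  where y = bmin s (λ z → not (pred (ap f s (z ∷ xs))))

aps []       s xs = []
aps (g ∷ gs) s xs = ap g s xs ∷ aps gs s xs

apF  : ∀ {n} (p : PR n) → Σ (Fun (suc n)) λ F → ∀ s xs → fn F (s ∷ xs) ≡ ap p s xs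
apFs : ∀ {m n} (ps : Vec (PR n) m) → Σ (Vec (Fun (suc n)) m) λ Fs → ∀ s xs → map (λ F → fn F (s ∷ xs)) Fs ≡ aps ps s xs

definedF : ∀ {m n} (Fs : Vec (Fun n) m) → Σ (Fun n) λ D → ∀ xs → fn D xs ≡ defined (map (λ F → fn F xs) Fs)
definedF []       = conF 1 , λ _ → refl
definedF (F ∷ Fs) = app₃ case0-c F zeroF (proj₁ (definedF Fs)) , λ xs → cong (case0 (fn F xs) 0) (proj₂ (definedF Fs) xs)

apF zer      = conF 1 , λ _ _ → refl
apF succ     = sucF (sucF v1) , λ { s (x ∷ []) → refl }
apF (proj i) = sucF (var (suc i)) , λ _ _ → refl
apF (comp f gs) = app₃ case0-c (proj₁ (definedF Gs)) zeroF (app F (v0 ∷ map (app₁ pred-c) Gs)) , λ s xs →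
  cong₂ (λ d → case0 d 0)
    (trans (proj₂ (definedF Gs) (s ∷ xs)) (cong defined (proj₂ (apFs gs) s xs)))
    (trans (cong (λ ys → fn F (s ∷ ys)) (preds s xs)) (proj₂ (apF f) s _))
  where
  F  = proj₁ (apF f)
  Gs = proj₁ (apFs gs)
  preds : ∀ s xs → map (λ G → fn G (s ∷ xs)) (map (app₁ pred-c) Gs) ≡ map pred (aps gs s xs)
  preds s xs = trans (sym (map-∘ _ _ Gs)) (trans (map-∘ pred _ Gs) (cong (map pred) (proj₂ (apFs gs) s xs)))
apF {suc n} (prec g h) = app R (v1 ∷ v0 ∷ map (λ i → var (suc (suc i))) (allFin n)) , λ { s (k ∷ xs) →
    trans (cong (λ ys → fn R (k ∷ s ∷ ys)) (map-wk (λ i → suc (suc i)) xs (s ∷ k ∷ xs) (λ _ → refl))) (go s k xs) }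
  where
  H : Fun (suc (suc (suc n)))
  H = app (proj₁ (apF h)) (v2 ∷ v0 ∷ app₁ pred-c v1 ∷ map (λ i → var (suc (suc (suc i)))) (allFin n))
  R = recF (proj₁ (apF g)) (app₃ case0-c v1 zeroF H)
  go : ∀ s k xs → fn R (k ∷ s ∷ xs) ≡ ap (prec g h) s (k ∷ xs)
  go s zero    xs = proj₂ (apF g) s xs
  go s (suc k) xs with fn R (k ∷ s ∷ xs) | go s k xs
  ... | r | refl = cong (case0 r 0) (trans
    (cong (λ ys → fn (proj₁ (apF h)) (s ∷ k ∷ pred r ∷ ys)) (map-wk (λ i → suc (suc (suc i))) xs (k ∷ r ∷ s ∷ xs) (λ _ → refl)))
    (proj₂ (apF h) s (k ∷ pred r ∷ xs)))
apF {n} (mu f) = app₃ case0-c (app₂ same-c (instF B Y) (conF 1)) zeroF (sucF Y) , λ _ _ → refl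
  where
  F = proj₁ (apF f)
  B : Fun (suc (suc n))
  B = cast (app F (v1 ∷ v0 ∷ map (λ i → var (suc (suc i))) (allFin n)))
           (λ { (z ∷ s ∷ xs) → ap f s (z ∷ xs) })
           (λ { (z ∷ s ∷ xs) → trans (cong (λ ys → fn F (s ∷ z ∷ ys)) (map-wk (λ i → suc (suc i)) xs (z ∷ s ∷ xs) (λ _ → refl)))
                                     (proj₂ (apF f) s (z ∷ xs)) })
  Y = bminF v0 (app₁ not-c (app₁ pred-c B))

apFs []       = [] , λ _ _ → refl
apFs (p ∷ ps) = proj₁ (apF p) ∷ proj₁ (apFs ps) , λ s xs → cong₂ _∷_ (proj₂ (apF p) s xs) (proj₂ (apFs ps) s xs)

defined-elim : ∀ {m} (vs : Vec ℕ m) → defined vs ≢ 0 → vs ≡ map suc (map pred vs)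
defined-elim []           h = refl
defined-elim (zero ∷ vs)  h = contradiction refl h
defined-elim (suc v ∷ vs) h = cong (suc v ∷_) (defined-elim vs h)

defined-suc : ∀ {m} (ys : Vec ℕ m) → defined (map suc ys) ≢ 0
defined-suc []       = suc≢0
defined-suc (y ∷ ys) = defined-suc ys

map-pred-suc : ∀ {m} (ys : Vec ℕ m) → map pred (map suc ys) ≡ ys
map-pred-suc []       = refl
map-pred-suc (y ∷ ys) = cong (y ∷_) (map-pred-suc ys)

case0-suc : ∀ {n b v} → case0 n 0 b ≡ suc v → n ≢ 0 × b ≡ suc v
case0-suc {zero}  ()
case0-suc {suc n} h = suc≢0 , h

ap-sound  : ∀ {n} (p : PR n) s xs {v} → ap p s xs ≡ suc v → Eval p xs v
aps-sound : ∀ {m n} (ps : Vec (PR n) m) s xs {ys} → aps ps s xs ≡ map suc ys → EvalVec ps xs ys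

ap-sound zer         s xs       refl = ev-zer
ap-sound succ        s (x ∷ []) refl = ev-succ
ap-sound (proj i)    s xs       refl = ev-proj
ap-sound (comp f gs) s xs       h with case0-suc {defined (aps gs s xs)} h
... | d , h′ = ev-comp (aps-sound gs s xs (defined-elim _ d)) (ap-sound f s _ h′)
ap-sound (prec g h)  s (k ∷ xs) e = go k e
  where
  go : ∀ k {v} → ap (prec g h) s (k ∷ xs) ≡ suc v → Eval (prec g h) (k ∷ xs) v
  go zero    e = ev-prec-z (ap-sound g s xs e)
  go (suc k) e with case0-suc {ap (prec g h) s (k ∷ xs)} e
  ... | d , e′ = ev-prec-s (go k (≢0⇒≡suc d)) (ap-sound h s _ e′)
-- The search stops at the first argument where f is not seen to be positive, be its value 0 or
-- still missing. The comparison with 1 accepts only the value 0, and all arguments passed over have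
-- positive values.
ap-sound (mu f) s xs h with case0-suc {same (ap f s (_ ∷ xs)) 1} h
... | d , refl = ev-mu (ap-sound f s _ (same-elim d)) λ z z<y →
  _ , ap-sound f s _ (positive (ap f s (z ∷ xs)) (not-≡0⁻¹ (bmin-< s _ z<y)))
  where
  positive : ∀ a → pred a ≢ 0 → a ≡ suc (suc (pred (pred a)))
  positive zero          h = contradiction refl h
  positive (suc zero)    h = contradiction refl h
  positive (suc (suc a)) h = refl

aps-sound []       s xs {[]}     h = ev-[]
aps-sound (p ∷ ps) s xs {y ∷ ys} h = ev-∷ (ap-sound p s xs (cong head h)) (aps-sound ps s xs (cong tail h))

Eventually : (ℕ → Set) → Set
Eventually P = ∃ λ t → ∀ s → t ≤ s → P s

ev-× : ∀ {P Q : ℕ → Set} → Eventually P → Eventually Q → Eventually (λ s → P s × Q s)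
ev-× (t , p) (u , q) = t ⊔ u , λ s le → p s (m⊔n≤o⇒m≤o t u le) , q s (m⊔n≤o⇒n≤o t u le)

ev-map : ∀ {P Q : ℕ → Set} → (∀ s → P s → Q s) → Eventually P → Eventually Q
ev-map f (t , p) = t , λ s le → f s (p s le)

ev-∀< : ∀ {P : ℕ → ℕ → Set} n → (∀ k → k < n → Eventually (P k)) → Eventually (λ s → ∀ k → k < n → P k s)
ev-∀< zero    h = 0 , λ _ _ _ ()
ev-∀< {P} (suc n) h = ev-map join (ev-× (ev-∀< n (λ k k<n → h k (m≤n⇒m≤1+n k<n))) (h n ≤-refl))
  where
  join : ∀ s → (∀ k → k < n → P k s) × P n s → ∀ k → k < suc n → P k s
  join s (p , q) k k< with m≤n⇒m<n∨m≡n (≤-pred k<)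
  ... | inj₁ k<n  = p k k<n
  ... | inj₂ refl = q

-- Claiming success for all large fuels lets the finitely many subcomputations share one fuel, by
-- `ev-×` and `ev-∀<`. For `mu` the fuel must also reach the result y, since it bounds the search.
ap-complete  : ∀ {n} (p : PR n) xs {v} → Eval p xs v → Eventually (λ s → ap p s xs ≡ suc v)
aps-complete : ∀ {m n} (ps : Vec (PR n) m) xs {ys} → EvalVec ps xs ys → Eventually (λ s → aps ps s xs ≡ map suc ys)

ap-complete zer      xs ev-zer  = 0 , λ _ _ → refl
ap-complete succ     xs ev-succ = 0 , λ _ _ → refl
ap-complete (proj i) xs ev-proj = 0 , λ _ _ → refl
ap-complete (comp f gs) xs (ev-comp {ys = ys} es e) = ev-map step (ev-× (aps-complete gs xs es) (ap-complete f ys e))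
  where
  step : ∀ s → aps gs s xs ≡ map suc ys × ap f s ys ≡ suc _ → ap (comp f gs) s xs ≡ suc _
  step s (h , h′) rewrite h | map-pred-suc ys = trans (case0-≢0 (defined-suc ys)) h′
ap-complete (prec g h) (k ∷ xs) e = go k e
  where
  go : ∀ k {v} → Eval (prec g h) (k ∷ xs) v → Eventually (λ s → ap (prec g h) s (k ∷ xs) ≡ suc v)
  go zero    (ev-prec-z e) = ap-complete g xs e
  go (suc k) (ev-prec-s {r = r} e e′) = ev-map (λ s (h₁ , h₂) → step s h₁ h₂) (ev-× (go k e) (ap-complete h (k ∷ r ∷ xs) e′))
    where
    step : ∀ s {v} → ap (prec g h) s (k ∷ xs) ≡ suc r → ap h s (k ∷ r ∷ xs) ≡ suc v → ap (prec g h) s (suc k ∷ xs) ≡ suc v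
    step s h₁ h₂ rewrite h₁ = h₂
ap-complete (mu f) xs (ev-mu {y = y} e es) =
  ev-map step (ev-× (y , λ _ le → le) (ev-× (ap-complete f (y ∷ xs) e)
    (ev-∀< y λ z z<y → ev-map (λ _ eq → _ , eq) (ap-complete f (z ∷ xs) (proj₂ (es z z<y))))))
  where
  step : ∀ s → y ≤ s × (ap f s (y ∷ xs) ≡ 1 × (∀ z → z < y → ∃ λ k → ap f s (z ∷ xs) ≡ suc (suc k))) → ap (mu f) s xs ≡ suc y
  step s (y≤s , h , hs) = trans (cong (λ w → case0 (same (ap f s (w ∷ xs)) 1) 0 (suc w)) least)
                                (case0-≢0 (same-intro h))
    where
    P = λ z → not (pred (ap f s (z ∷ xs)))
    found = bmin-least s P y≤s (not-≢0 (cong pred h))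
    least : bmin s P ≡ y
    least with m≤n⇒m<n∨m≡n (proj₂ found)
    ... | inj₂ eq = eq
    ... | inj₁ lt = contradiction (cong (λ a → not (pred a)) (proj₂ (hs _ lt))) (proj₁ found)

aps-complete []       xs ev-[]       = 0 , λ _ _ → refl
aps-complete (p ∷ ps) xs (ev-∷ e es) =
  ev-map (λ _ (h , h′) → cong₂ _∷_ h h′) (ev-× (ap-complete p xs e) (aps-complete ps xs es))

-- At a common large fuel both results are the one value of `ap`.
Eval-functional : ∀ {n} (p : PR n) xs {v w} → Eval p xs v → Eval p xs w → v ≡ w
Eval-functional p xs e e′ with ev-× (ap-complete p xs e) (ap-complete p xs e′)
... | t , h = suc-injective (trans (sym (proj₁ (h t ≤-refl))) (proj₂ (h t ≤-refl)))

-- The finite injury construction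

-- In mode 0, K is the part of φ_target seen by stage mark, and A is K together with the value level at mark.
-- In modes 1 and 2, A = K copies φ_target; this lasts until x differs from witness in mode 1, and for ever in
-- mode 2, where Final copies φ_witness.
mode level mark target witness : ℕ → ℕ
mode    S = fst S
level   S = fst (snd S)
mark    S = fst (snd (snd S))
target  S = fst (snd (snd (snd S)))
witness S = snd (snd (snd (snd S)))

code : ℕ → ℕ → ℕ → ℕ → ℕ → ℕ
code m c p z x = pair m (pair c (pair p (pair z x)))

module Construction (T : ℕ → ℕ → ℕ → ℕ) (b₁ b₂ : ℕ → ℕ → ℕ) (h₁ h₂ h₃ h₄ : ℕ) where

  opaque
    hit : ℕ → ℕ → ℕ → ℕ
    hit s i j = same (T s j 0) (suc i)

    hits : ℕ → ℕ → ℕ → ℕ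
    hits s n i = any≤ n (hit s i)

    covered : ℕ → ℕ → ℕ
    covered s n = all≤ (suc h₃) (hits s n)

  opaque
    -- Searching over offsets makes x > h₃ hold by definition. The default offset h₄ is large enough
    -- in the limit, because the constants up to h₃ + 1 have indices up to h₄.
    x : ℕ → ℕ
    x s = suc (h₃ + bmin h₄ (λ k → covered s (suc (h₃ + k))))

  opaque
    K : ℕ → ℕ → ℕ → ℕ
    K S s q = case0 (mode S) (T (mark S) (target S) q) (T s (target S) q)

  opaque
    A : ℕ → ℕ → ℕ → ℕ
    A S s q = case0 (mode S) (case0 (neq q (mark S)) (suc (level S)) (T (mark S) (target S) q)) (T s (target S) q)

  opaque
    clash : ℕ → ℕ → ℕ → ℕ → ℕ
    clash S s z q = case0 (A S s q) 0 (neq (T s z q) (A S s q))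

    -- In mode 0 no argument of A exceeds the mark (`A-domain`), so checking up to the mark
    -- suffices.
    extends : ℕ → ℕ → ℕ → ℕ
    extends S s z = not (any≤ (mark S) (clash S s z))

  opaque
    -- The bound h₂ + 1 leaves room for a value above h₂, which says that no index up to h₂ is seen
    -- to extend A.
    z : ℕ → ℕ → ℕ
    z S s = bmin (suc h₂) (extends S s)

  opaque
    -- The vector (1, 0) excludes y ∉ MIN, w ∈ MIN and leads to mode 1; (1, 1) excludes y, w ∉ MIN
    -- and leads to mode 2. With first entry 0 the construction waits in mode 0.
    attack : ℕ → ℕ → ℕ → ℕ → ℕ
    attack S s y w = case0 (b₁ y w) S (code (case0 (b₂ y w) 1 2) (level S) (mark S) y w)

    next : ℕ → ℕ → ℕ
    next s S = case0 (mode S)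
      (case0 (z S s ∸ h₂)
        (case0 (z S s ∸ h₁) (code 0 (suc (level S)) (mark S) (target S) (witness S)) (attack S s (z S s) (x s)))
        S)
      (case0 (pred (mode S))
        (case0 (neq (x s) (witness S)) S (code 0 (level S) (suc s) (target S) (witness S)))
        S)

  opaque
    state : ℕ → ℕ
    state = rec (code 0 0 0 0 0) next

    state-zero : state 0 ≡ code 0 0 0 0 0
    state-zero = refl

    state-suc : ∀ s → state (suc s) ≡ next s (state s)
    state-suc s = refl

  -- The sum encodes a conjunction. The value is nonzero at the waiting stages for y with vector (0,
  -- 1), where x has to be pushed out of MIN.
  act : ℕ → ℕ → ℕ
  act y r = case0 (mode (state r) + neq (z (state r) r) y + b₁ y (x r)) (b₂ y (x r)) 0

  -- K lacks the value at the mark and therefore survives every bump, so one function serves all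
  -- levels.
  Kill : ℕ → ℕ → ℕ
  Kill q r = K (state r) r q

  -- A bump changes a value of A, so each level needs a function of its own; within a level A only
  -- grows.
  Grow : ℕ → ℕ → ℕ → ℕ
  Grow c q r = case0 (neq (level (state r)) c) (A (state r) r q) 0

  -- The function reserved for y copies the x of the first stage at which (b₁, b₂) excludes y ∈ MIN, x ∉ MIN;
  -- a later x is not needed, since φ_y can no longer be minimal.
  Copy : ℕ → ℕ → ℕ → ℕ
  Copy y q r = case0 (any≤ r (act y)) 0 (T r (x (bmin r (act y))) q)

  Final : ℕ → ℕ → ℕ
  Final q r = case0 (pred (mode (state r))) 0 (T r (witness (state r)) q)

case0-b-0 : ∀ {n b} → case0 n b 0 ≢ 0 → n ≡ 0 × b ≢ 0
case0-b-0 {zero}  h = refl , h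
case0-b-0 {suc n} h = contradiction refl h

-- G q r is the value at q (plus one) announced at stage r, or 0.
Realises : Numbering → ℕ → (ℕ → ℕ → ℕ) → Set
Realises φ j G = (∀ q v → Eval φ (j ∷ q ∷ []) v → ∃ λ r → G q r ≡ suc v)
               × (∀ q r → G q r ≢ 0 → ∃ λ r′ → ∃ λ v → G q r′ ≡ suc v × Eval φ (j ∷ q ∷ []) v)

-- Every strict decrease lowers the bound n on `f u`, so not all u can be followed by one. The last
-- decrease cannot be located constructively, whence the double negation; it suffices for deriving
-- `⊥`.
eventually-constant : (f : ℕ → ℕ) → (∀ s → f (suc s) ≤ f s) → ∀ t → ¬ ¬ (∃ λ u → t ≤ u × ∀ s → u ≤ s → f s ≡ f u)
eventually-constant f dec t k = go (f t) t ≤-refl ≤-refl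
  where
  decreasing : ∀ {s u} → u ≤ s → f s ≤ f u
  decreasing {zero}  z≤n = ≤-refl
  decreasing {suc s} u≤ with m≤n⇒m<n∨m≡n u≤
  ... | inj₁ (s≤s u≤s) = ≤-trans (dec s) (decreasing u≤s)
  ... | inj₂ refl      = ≤-refl
  go : ∀ n u → t ≤ u → f u ≤ n → ⊥
  stuck : ∀ n u → t ≤ u → f u ≤ n → ∀ s → u ≤ s → f s ≡ f u
  go n u t≤u fu≤n = k (u , t≤u , stuck n u t≤u fu≤n)
  stuck n u t≤u fu≤n s u≤s with m≤n⇒m<n∨m≡n (decreasing u≤s)
  ... | inj₂ eq = eq
  stuck zero    u t≤u fu≤n s u≤s | inj₁ lt = contradiction (≤-trans lt fu≤n) λ ()
  stuck (suc n) u t≤u fu≤n s u≤s | inj₁ lt = ⊥-elim (go n s (≤-trans t≤u u≤s) (≤-pred (≤-trans lt fu≤n)))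

-- Verification of the construction

module Analysis
  (φ : Numbering)
  (T : ℕ → ℕ → ℕ → ℕ)
  (T-mono : ∀ {s s′} j q {v} → T s j q ≡ suc v → s ≤ s′ → T s′ j q ≡ suc v)
  (T-fresh : ∀ s j q → s ≤ q → T s j q ≡ 0)
  (T-sound : ∀ s j q {v} → T s j q ≡ suc v → Eval φ (j ∷ q ∷ []) v)
  (T-complete : ∀ j q {v} → Eval φ (j ∷ q ∷ []) v → Eventually (λ s → T s j q ≡ suc v))
  (b₁ b₂ : ℕ → ℕ → ℕ)
  (agree : ∀ y w → AgreesWith (MIN φ) y (b₁ y w) ⊎ AgreesWith (MIN φ) w (b₂ y w))
  (h₁ h₂ h₃ h₄ : ℕ)
  where

  open Construction T b₁ b₂ h₁ h₂ h₃ h₄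

  m c p kz kx zc : ℕ → ℕ
  m s = mode (state s)
  c s = level (state s)
  p s = mark (state s)
  kz s = target (state s)
  kx s = witness (state s)
  zc s = z (state s) s

  Aₛ : ℕ → ℕ → ℕ
  Aₛ s q = A (state s) s q

  dead : ∀ {j w} → j < w → SameFn φ j φ w → ¬ MIN φ w
  dead j<w same min = min _ j<w same

  T-unique : ∀ {s s′ j q v w} → T s j q ≡ suc v → T s′ j q ≡ suc w → v ≡ w
  T-unique {s} {s′} {j} {q} h h′ = suc-injective (trans (sym (T-mono j q h (m≤m⊔n s s′))) (T-mono j q h′ (m≤n⊔m s s′)))

  -- Steps of the state

  m-zero : m 0 ≡ 0
  m-zero = trans (cong mode state-zero) (fst-pair 0 _)

  c-zero : c 0 ≡ 0
  c-zero = trans (cong level state-zero) (trans (cong fst (snd-pair 0 _)) (fst-pair 0 _))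

  data Next (s m′ c′ p′ kz′ kx′ : ℕ) : Set where
    fields : m (suc s) ≡ m′ → c (suc s) ≡ c′ → p (suc s) ≡ p′ → kz (suc s) ≡ kz′ → kx (suc s) ≡ kx′ →
             Next s m′ c′ p′ kz′ kx′

  next-code : ∀ s {m′ c′ p′ kz′ kx′} → next s (state s) ≡ code m′ c′ p′ kz′ kx′ → Next s m′ c′ p′ kz′ kx′
  next-code s {m′} {c′} {p′} {kz′} {kx′} eq′ = fields
    (trans (cong mode eq) (fst-pair m′ _))
    (trans (cong level eq) (trans (cong fst e₁) (fst-pair c′ _)))
    (trans (cong mark eq) (trans (cong (λ S → fst (snd S)) e₁) (trans (cong fst e₂) (fst-pair p′ _))))
    (trans (cong target eq) (trans (cong (λ S → fst (snd (snd S))) e₁)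
      (trans (cong (λ S → fst (snd S)) e₂) (trans (cong fst e₃) (fst-pair kz′ kx′)))))
    (trans (cong witness eq) (trans (cong (λ S → snd (snd (snd S))) e₁)
      (trans (cong (λ S → snd (snd S)) e₂) (trans (cong snd e₃) (snd-pair kz′ kx′)))))
    where
    eq = trans (state-suc s) eq′
    e₃ : snd (pair p′ (pair kz′ kx′)) ≡ pair kz′ kx′
    e₃ = snd-pair p′ _
    e₂ : snd (pair c′ (pair p′ (pair kz′ kx′))) ≡ pair p′ (pair kz′ kx′)
    e₂ = snd-pair c′ _
    e₁ : snd (code m′ c′ p′ kz′ kx′) ≡ pair c′ (pair p′ (pair kz′ kx′))
    e₁ = snd-pair m′ _

  next-same : ∀ s → next s (state s) ≡ state s → Next s (m s) (c s) (p s) (kz s) (kx s)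
  next-same s eq′ = fields (cong mode eq) (cong level eq) (cong mark eq) (cong target eq) (cong witness eq)
    where eq = trans (state-suc s) eq′

  -- A view of `next`: each transition comes with the conditions that select it, so that every
  -- invariant needs just one case distinction.
  data Step (s : ℕ) : Set where
    idle  : m s ≡ 0 → (h₂ < zc s) ⊎ (h₁ < zc s × zc s ≤ h₂ × b₁ (zc s) (x s) ≡ 0) →
            Next s (m s) (c s) (p s) (kz s) (kx s) → Step s
    bump  : m s ≡ 0 → zc s ≤ h₁ → zc s ≤ h₂ → Next s 0 (suc (c s)) (p s) (kz s) (kx s) → Step s
    enter : m s ≡ 0 → h₁ < zc s → zc s ≤ h₂ → b₁ (zc s) (x s) ≢ 0 →
            Next s (case0 (b₂ (zc s) (x s)) 1 2) (c s) (p s) (zc s) (x s) → Step s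
    exit  : m s ≡ 1 → x s ≢ kx s → Next s 0 (c s) (suc s) (kz s) (kx s) → Step s
    hold  : m s ≢ 0 → (m s ≡ 1 → x s ≡ kx s) → Next s (m s) (c s) (p s) (kz s) (kx s) → Step s

  opaque
    unfolding next

    step : ∀ s → Step s
    step s with m s ≟ 0
    ... | yes m0 with zc s ≤? h₂
    ...   | no z≰h₂ = idle m0 (inj₁ (≰⇒> z≰h₂)) (next-same s (trans (case0-≡0 m0) (case0-≢0 (m>n⇒m∸n≢0 (≰⇒> z≰h₂)))))
    ...   | yes z≤h₂ with zc s ≤? h₁
    ...     | yes z≤h₁ = bump m0 z≤h₁ z≤h₂
      (next-code s (trans (case0-≡0 m0) (trans (case0-≡0 (m≤n⇒m∸n≡0 z≤h₂)) (case0-≡0 (m≤n⇒m∸n≡0 z≤h₁)))))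
    ...     | no z≰h₁ with b₁ (zc s) (x s) ≟ 0
    ...       | yes b0 = idle m0 (inj₂ (≰⇒> z≰h₁ , z≤h₂ , b0))
      (next-same s (trans (case0-≡0 m0) (trans (case0-≡0 (m≤n⇒m∸n≡0 z≤h₂))
        (trans (case0-≢0 (m>n⇒m∸n≢0 (≰⇒> z≰h₁))) (case0-≡0 b0)))))
    ...       | no b≢0 = enter m0 (≰⇒> z≰h₁) z≤h₂ b≢0
      (next-code s (trans (case0-≡0 m0) (trans (case0-≡0 (m≤n⇒m∸n≡0 z≤h₂))
        (trans (case0-≢0 (m>n⇒m∸n≢0 (≰⇒> z≰h₁))) (case0-≢0 b≢0)))))
    step s | no m≢0 with m s ≟ 1
    ...   | no m≢1 = hold m≢0 (λ m1 → contradiction m1 m≢1) (next-same s (trans (case0-≢0 m≢0) (case0-≢0 pm)))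
      where
      pm : pred (m s) ≢ 0
      pm h = m≢1 (trans (≢0⇒≡suc m≢0) (cong suc h))
    ...   | yes m1 with x s ≟ kx s
    ...     | yes x≡ = hold m≢0 (λ _ → x≡) (next-same s
      (trans (case0-≢0 m≢0) (trans (case0-≡0 (cong pred m1)) (case0-≡0 (trans (cong (neq (x s)) (sym x≡)) (neq-refl (x s)))))))
    ...     | no x≢ = exit m1 x≢ (next-code s (trans (case0-≢0 m≢0) (trans (case0-≡0 (cong pred m1)) (case0-≢0 (neq-≢0 x≢)))))

  -- The approximations A and K

  opaque
    unfolding A

    A-mark : ∀ s → m s ≡ 0 → Aₛ s (p s) ≡ suc (c s)
    A-mark s m0 = trans (case0-≡0 m0) (case0-≡0 (neq-refl (p s)))

    A-0 : ∀ s {q} → m s ≡ 0 → q ≢ p s → Aₛ s q ≡ T (p s) (kz s) q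
    A-0 s m0 q≢p = trans (case0-≡0 m0) (case0-≢0 (neq-≢0 q≢p))

    A-1 : ∀ s {q} → m s ≢ 0 → Aₛ s q ≡ T s (kz s) q
    A-1 s m≢0 = case0-≢0 m≢0

  opaque
    unfolding K

    K-0 : ∀ s {q} → m s ≡ 0 → Kill q s ≡ T (p s) (kz s) q
    K-0 s m0 = case0-≡0 m0

    K-1 : ∀ s {q} → m s ≢ 0 → Kill q s ≡ T s (kz s) q
    K-1 s m≢0 = case0-≢0 m≢0

  T-domain : ∀ s j q {v} → T s j q ≡ suc v → q < s
  T-domain s j q h with q <? s
  ... | yes q<s = q<s
  ... | no  q≮s = contradiction (trans (sym h) (T-fresh s j q (≮⇒≥ q≮s))) λ ()

  -- In mode 0 all arguments of K lie strictly below the mark, by `T-fresh`, so the extra value of A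
  -- hides nothing.
  K⊆A : ∀ s q {v} → Kill q s ≡ suc v → Aₛ s q ≡ suc v
  K⊆A s q h with m s ≟ 0
  ... | yes m0 = trans (A-0 s m0 (<⇒≢ (T-domain _ _ _ h′))) h′
    where h′ = trans (sym (K-0 s m0)) h
  ... | no m≢0 = trans (A-1 s m≢0) (trans (sym (K-1 s m≢0)) h)

  A-domain : ∀ s q {v} → m s ≡ 0 → Aₛ s q ≡ suc v → q ≤ p s
  A-domain s q m0 h with q ≟ p s
  ... | yes refl = ≤-refl
  ... | no  q≢p  = <⇒≤ (T-domain _ _ _ (trans (sym (A-0 s m0 q≢p)) h))

  opaque
    unfolding extends

    extends-elim : ∀ s y → m s ≡ 0 → extends (state s) s y ≢ 0 → ∀ q {v} → Aₛ s q ≡ suc v → T s y q ≡ suc v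
    extends-elim s y m0 e q {v} h = trans (neq-≡0 _ _ agreeing) h
      where
      agreeing : neq (T s y q) (Aₛ s q) ≡ 0
      agreeing with neq (T s y q) (Aₛ s q) ≟ 0
      ... | yes eq = eq
      ... | no  ne = contradiction (not-≢0⁻¹ e) (any-intro (p s) (clash (state s) s y) (A-domain s q m0 h)
                       (λ eq → ne (trans (sym (case0-≢0 (≡suc⇒≢0 h))) eq)))

    extends-intro : ∀ s y → (∀ q {v} → q ≤ p s → Aₛ s q ≡ suc v → T s y q ≡ suc v) → extends (state s) s y ≢ 0
    extends-intro s y h with any≤ (p s) (clash (state s) s y) ≟ 0
    ... | yes eq = not-≢0 eq
    ... | no  ne with any-elim (p s) (clash (state s) s y) ne
    ...   | q , q≤p , cl with Aₛ s q in eq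
    ...     | zero  = contradiction refl cl
    ...     | suc v = contradiction (trans (cong (λ t → neq t (suc v)) (h q q≤p eq)) (neq-refl (suc v))) cl

  opaque
    unfolding z

    z-extends : ∀ s → m s ≡ 0 → zc s ≤ h₂ → ∀ q {v} → Aₛ s q ≡ suc v → T s (zc s) q ≡ suc v
    z-extends s m0 z≤h₂ = extends-elim s (zc s) m0
      λ h → contradiction (bmin-≡0 (suc h₂) (extends (state s) s) h) (<⇒≢ (s≤s z≤h₂))

    z-least : ∀ s y → y ≤ h₂ → (∀ q {v} → q ≤ p s → Aₛ s q ≡ suc v → T s y q ≡ suc v) → zc s ≤ y
    z-least s y y≤h₂ h = proj₂ (bmin-least (suc h₂) (extends (state s) s) (m≤n⇒m≤1+n y≤h₂) (extends-intro s y h))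

    z-antitone : ∀ s u → (∀ y → extends (state u) u y ≢ 0 → extends (state s) s y ≢ 0) → zc s ≤ zc u
    z-antitone s u h = bmin-antitone (suc h₂) _ _ h

  case0-1-2 : ∀ b → case0 b 1 2 ≢ 0
  case0-1-2 zero    ()
  case0-1-2 (suc _) ()

  A-next-0 : ∀ s {m′ c′ p′ kz′ kx′ q} → Next s m′ c′ p′ kz′ kx′ → m′ ≡ 0 → q ≢ p′ → Aₛ (suc s) q ≡ T p′ kz′ q
  A-next-0 s (fields refl refl refl refl refl) m0 q≢p = A-0 (suc s) m0 q≢p

  A-next-mark : ∀ s {m′ c′ p′ kz′ kx′} → Next s m′ c′ p′ kz′ kx′ → m′ ≡ 0 → Aₛ (suc s) p′ ≡ suc c′
  A-next-mark s (fields refl refl refl refl refl) m0 = A-mark (suc s) m0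

  A-next-1 : ∀ s {m′ c′ p′ kz′ kx′ q} → Next s m′ c′ p′ kz′ kx′ → m′ ≢ 0 → Aₛ (suc s) q ≡ T (suc s) kz′ q
  A-next-1 s (fields refl refl refl refl refl) m≢0 = A-1 (suc s) m≢0

  K-next-0 : ∀ s {m′ c′ p′ kz′ kx′ q} → Next s m′ c′ p′ kz′ kx′ → m′ ≡ 0 → Kill q (suc s) ≡ T p′ kz′ q
  K-next-0 s (fields refl refl refl refl refl) m0 = K-0 (suc s) m0

  K-next-1 : ∀ s {m′ c′ p′ kz′ kx′ q} → Next s m′ c′ p′ kz′ kx′ → m′ ≢ 0 → Kill q (suc s) ≡ T (suc s) kz′ q
  K-next-1 s (fields refl refl refl refl refl) m≢0 = K-1 (suc s) m≢0

  level-next : ∀ s {m′ c′ p′ kz′ kx′} → Next s m′ c′ p′ kz′ kx′ → c (suc s) ≡ c′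
  level-next s (fields _ eq _ _ _) = eq

  mode-next : ∀ s {m′ c′ p′ kz′ kx′} → Next s m′ c′ p′ kz′ kx′ → m (suc s) ≡ m′
  mode-next s (fields eq _ _ _ _) = eq

  -- The critical transition is `enter`, where K becomes the current part of φ_z: there z extends A
  -- and hence K.
  Kill-mono₁ : ∀ s q {v} → Kill q s ≡ suc v → Kill q (suc s) ≡ suc v
  Kill-mono₁ s q h with step s
  ... | idle m0 _ n    = trans (K-next-0 s n m0) (trans (sym (K-0 s m0)) h)
  ... | bump m0 _ _ n  = trans (K-next-0 s n refl) (trans (sym (K-0 s m0)) h)
  ... | enter m0 _ z≤h₂ _ n = trans (K-next-1 s n (case0-1-2 _)) (T-mono _ q (z-extends s m0 z≤h₂ q (K⊆A s q h)) (n≤1+n s))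
  ... | exit m1 _ n    = trans (K-next-0 s n refl) (T-mono _ q (trans (sym (K-1 s (≡suc⇒≢0 m1))) h) (n≤1+n s))
  ... | hold m≢0 _ n   = trans (K-next-1 s n m≢0) (T-mono _ q (trans (sym (K-1 s m≢0)) h) (n≤1+n s))

  c-mono₁ : ∀ s → c s ≤ c (suc s)
  c-mono₁ s with step s
  ... | idle _ _ n      = ≤-reflexive (sym (level-next s n))
  ... | bump _ _ _ n    = ≤-trans (n≤1+n _) (≤-reflexive (sym (level-next s n)))
  ... | enter _ _ _ _ n = ≤-reflexive (sym (level-next s n))
  ... | exit _ _ n      = ≤-reflexive (sym (level-next s n))
  ... | hold _ _ n      = ≤-reflexive (sym (level-next s n))

  -- Only a bump alters a value, and it raises the one at the mark. Monotonicity keeps a raised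
  -- value from ever returning to the old one; constancy within a level makes `Grow` single-valued.
  A-mono₁ : ∀ s q {v} → Aₛ s q ≡ suc v → ∃ λ v′ → v ≤ v′ × Aₛ (suc s) q ≡ suc v′ × (c s ≡ c (suc s) → v ≡ v′)
  A-mono₁ s q {v} h with step s
  ... | enter m0 _ z≤h₂ _ n = v , ≤-refl ,
    trans (A-next-1 s n (case0-1-2 _)) (T-mono _ q (z-extends s m0 z≤h₂ q h) (n≤1+n s)) , λ _ → refl
  ... | hold m≢0 _ n   = v , ≤-refl , trans (A-next-1 s n m≢0) (T-mono _ q (trans (sym (A-1 s m≢0)) h) (n≤1+n s)) , λ _ → refl
  -- All arguments of A lie below s, so the new mark `suc s` is a fresh one.
  ... | exit m1 _ n    = v , ≤-refl ,
    trans (A-next-0 s n refl (<⇒≢ (m≤n⇒m≤1+n (T-domain _ _ _ h′)))) (T-mono _ q h′ (n≤1+n s)) , λ _ → refl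
    where h′ = trans (sym (A-1 s (≡suc⇒≢0 m1))) h
  ... | idle m0 _ n with q ≟ p s
  ...   | yes refl = v , ≤-refl , trans (A-next-mark s n m0) (trans (sym (A-mark s m0)) h) , λ _ → refl
  ...   | no q≢p   = v , ≤-refl , trans (A-next-0 s n m0 q≢p) (trans (sym (A-0 s m0 q≢p)) h) , λ _ → refl
  A-mono₁ s q {v} h | bump m0 _ _ n with q ≟ p s
  ...   | no q≢p   = v , ≤-refl , trans (A-next-0 s n refl q≢p) (trans (sym (A-0 s m0 q≢p)) h) , λ _ → refl
  ...   | yes refl = suc (c s) , ≤-trans (≤-reflexive v≡c) (n≤1+n _) , A-next-mark s n refl ,
                     λ eq → contradiction (trans eq (level-next s n)) (<⇒≢ ≤-refl)
    where
    v≡c : v ≡ c s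
    v≡c = suc-injective (trans (sym h) (A-mark s m0))

  ≤-iterate : (P : ℕ → Set) → (∀ s → P s → P (suc s)) → ∀ {s u} → s ≤ u → P s → P u
  ≤-iterate P f {s} {zero}  z≤n Ps = Ps
  ≤-iterate P f {s} {suc u} s≤ Ps with m≤n⇒m<n∨m≡n s≤
  ... | inj₁ (s≤s s≤u) = f u (≤-iterate P f s≤u Ps)
  ... | inj₂ refl      = Ps

  Kill-mono : ∀ {s u} q {v} → s ≤ u → Kill q s ≡ suc v → Kill q u ≡ suc v
  Kill-mono q {v} = ≤-iterate (λ u → Kill q u ≡ suc v) (λ u → Kill-mono₁ u q)

  c-mono : ∀ {s u} → s ≤ u → c s ≤ c u
  c-mono {s} s≤u = ≤-iterate (λ u → c s ≤ c u) (λ u h → ≤-trans h (c-mono₁ u)) s≤u ≤-refl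

  A-mono : ∀ {s u} q {v} → s ≤ u → Aₛ s q ≡ suc v → ∃ λ v′ → v ≤ v′ × Aₛ u q ≡ suc v′
  A-mono q {v} s≤u h = ≤-iterate (λ u → ∃ λ v′ → v ≤ v′ × Aₛ u q ≡ suc v′)
    (λ u (w , v≤w , e) → let w′ , w≤w′ , e′ , _ = A-mono₁ u q e in w′ , ≤-trans v≤w w≤w′ , e′) s≤u (v , ≤-refl , h)

  A-level : ∀ {s u} q {v} → s ≤ u → c s ≡ c u → Aₛ s q ≡ suc v → Aₛ u q ≡ suc v
  A-level {s} q {v} s≤u cs≡cu h =
    proj₂ (≤-iterate (λ u → s ≤ u × (c s ≡ c u → Aₛ u q ≡ suc v)) next-stage s≤u (≤-refl , λ _ → h)) cs≡cu
    where
    next-stage : ∀ u → s ≤ u × (c s ≡ c u → Aₛ u q ≡ suc v) → s ≤ suc u × (c s ≡ c (suc u) → Aₛ (suc u) q ≡ suc v)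
    next-stage u (s≤u , IH) = m≤n⇒m≤1+n s≤u , λ eq →
      let cs≡cu = ≤-antisym (c-mono s≤u) (≤-trans (c-mono₁ u) (≤-reflexive (sym eq)))
          _ , _ , h′ , v≡ = A-mono₁ u q (IH cs≡cu)
      in trans h′ (cong suc (sym (v≡ (trans (sym cs≡cu) eq))))

  Bump : ℕ → Set
  Bump k = ∃ λ r → c r ≡ k × m r ≡ 0 × zc r ≤ h₁ × zc r ≤ h₂ × Aₛ (suc r) (p r) ≡ suc (suc (c r))

  -- The level starts at 0 and rises by one at a time, so each smaller level was left through a
  -- bump.
  bumps : ∀ s k → k < c s → Bump k
  bumps zero    k k<c = contradiction (subst (k <_) c-zero k<c) λ ()
  bumps (suc s) k k<c with step s
  ... | idle _ _ n      = bumps s k (subst (k <_) (level-next s n) k<c)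
  ... | enter _ _ _ _ n = bumps s k (subst (k <_) (level-next s n) k<c)
  ... | exit _ _ n      = bumps s k (subst (k <_) (level-next s n) k<c)
  ... | hold _ _ n      = bumps s k (subst (k <_) (level-next s n) k<c)
  ... | bump m0 z≤h₁ z≤h₂ n with m≤n⇒m<n∨m≡n (≤-pred (subst (k <_) (level-next s n) k<c))
  ...   | inj₁ k<cs = bumps s k k<cs
  ...   | inj₂ k≡cs = s , sym k≡cs , m0 , z≤h₁ , z≤h₂ , A-next-mark s n refl

  -- A bump changes A at its mark, and A keeps disagreeing there with the index that caused the bump.
  bump-distinct : ∀ {k k′} (B : Bump k) (B′ : Bump k′) → k < k′ → zc (proj₁ B) ≢ zc (proj₁ B′)
  bump-distinct (r , refl , m0 , _ , z≤h₂ , h) (r′ , refl , m0′ , _ , z≤h₂′ , _) k<k′ z≡ with A-mono (p r) r<r′ h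
    where
    r<r′ : r < r′
    r<r′ with r <? r′
    ... | yes lt = lt
    ... | no  ≮  = contradiction (c-mono (≮⇒≥ ≮)) (<⇒≱ k<k′)
  ... | w , c<w , h′ = contradiction
    (T-unique (z-extends r m0 z≤h₂ (p r) (A-mark r m0))
              (subst (λ y → T r′ y (p r) ≡ suc w) (sym z≡) (z-extends r′ m0′ z≤h₂′ (p r) h′)))
    (<⇒≢ c<w)

  -- Every bump is caused by an index up to h₁ and no index causes two, so the pigeonhole principle
  -- allows at most h₁ + 1 bumps.
  c-bound : ∀ s → c s ≤ suc h₁
  c-bound s with c s ≤? suc h₁
  ... | yes le = le
  ... | no  ≰  = ⊥-elim (collision (pigeonhole ≤-refl index))
    where
    B : (i : Fin (suc (suc h₁))) → Bump (toℕ i)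
    B i = bumps s (toℕ i) (<-≤-trans (toℕ<n i) (≰⇒> ≰))
    index : Fin (suc (suc h₁)) → Fin (suc h₁)
    index i = fromℕ< (s≤s (proj₁ (proj₂ (proj₂ (proj₂ (B i))))))
    collision : (∃ λ i → ∃ λ j → toℕ i < toℕ j × index i ≡ index j) → ⊥
    collision (i , j , i<j , eq) =
      bump-distinct (B i) (B j) i<j (trans (sym (toℕ-fromℕ< _)) (trans (cong toℕ eq) (toℕ-fromℕ< _)))

  -- The approximation x

  opaque
    unfolding covered

    covered-intro : ∀ s n → (∀ i → i ≤ suc h₃ → ∃ λ j → j ≤ n × T s j 0 ≡ suc i) → covered s n ≢ 0
    covered-intro s n h = all-intro (suc h₃) (hits s n) λ i i≤ →
      let j , j≤n , e = h i i≤ in any-intro n (hit s i) j≤n (same-intro e)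

    covered-elim : ∀ s n → covered s n ≢ 0 → ∀ i → i ≤ suc h₃ → ∃ λ j → j ≤ n × T s j 0 ≡ suc i
    covered-elim s n h i i≤ =
      let j , j≤n , e = any-elim n (hit s i) (all-elim (suc h₃) (hits s n) h i i≤) in j , j≤n , same-elim e

    covered-≡0 : ∀ s n → covered s n ≡ 0 → ∃ λ i → i ≤ suc h₃ × ∀ j → j ≤ n → T s j 0 ≢ suc i
    covered-≡0 s n h =
      let i , i≤ , e = all-≡0 (suc h₃) (hits s n) h in i , i≤ , λ j j≤n e′ → any-intro n (hit s i) j≤n (same-intro e′) e

    covered-mono : ∀ {s u} n → s ≤ u → covered s n ≢ 0 → covered u n ≢ 0
    covered-mono {s} {u} n s≤u h = covered-intro u n λ i i≤ →
      let j , j≤n , e = covered-elim s n h i i≤ in j , j≤n , T-mono j 0 e s≤u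

  -- There are h₃ + 2 values to cover but only h₃ + 1 indices.
  not-covered-h₃ : ∀ s → covered s h₃ ≡ 0
  not-covered-h₃ s with covered s h₃ ≟ 0
  ... | yes eq = eq
  ... | no  h  = ⊥-elim (collision (pigeonhole ≤-refl index))
    where
    found : (i : Fin (suc (suc h₃))) → ∃ λ j → j ≤ h₃ × T s j 0 ≡ suc (toℕ i)
    found i = covered-elim s h₃ h (toℕ i) (≤-pred (toℕ<n i))
    index : Fin (suc (suc h₃)) → Fin (suc h₃)
    index i = fromℕ< (s≤s (proj₁ (proj₂ (found i))))
    collision : (∃ λ i → ∃ λ i′ → toℕ i < toℕ i′ × index i ≡ index i′) → ⊥
    collision (i , i′ , i<i′ , eq) = <⇒≢ i<i′ (suc-injective (trans (sym (proj₂ (proj₂ (found i))))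
      (trans (cong (λ j → T s j 0) (trans (sym (toℕ-fromℕ< _)) (trans (cong toℕ eq) (toℕ-fromℕ< _)))) (proj₂ (proj₂ (found i′))))))

  opaque
    unfolding x

    -- If n ≤ h₃, there are too few indices; otherwise the search for x has passed over n.
    not-covered-below : ∀ s {n} → suc n ≡ x s → covered s n ≡ 0
    not-covered-below s {n} eq with n ≤? h₃
    ... | yes n≤h₃ with covered s n ≟ 0
    ...   | yes eq′ = eq′
    ...   | no  h   = contradiction (not-covered-h₃ s)
      (covered-intro s h₃ λ i i≤ → let j , j≤n , e = covered-elim s n h i i≤ in j , ≤-trans j≤n n≤h₃ , e)
    not-covered-below s {n} eq | no n≰h₃ = subst (λ n → covered s n ≡ 0) n≡ (bmin-< h₄ _ lt)
      where
      n≡ : suc (h₃ + (n ∸ suc h₃)) ≡ n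
      n≡ = m+[n∸m]≡n (≰⇒> n≰h₃)
      lt : n ∸ suc h₃ < bmin h₄ (λ k → covered s (suc (h₃ + k)))
      lt = +-cancelˡ-≤ h₃ _ _ (≤-reflexive (trans (+-suc h₃ _) (trans n≡ (suc-injective eq))))

    x-mono₁ : ∀ s → x (suc s) ≤ x s
    x-mono₁ s = s≤s (+-monoʳ-≤ h₃ (bmin-antitone h₄ _ _ λ k → covered-mono _ (n≤1+n s)))

    x-attained : ∀ s → covered s (suc (h₃ + h₄)) ≢ 0 → covered s (x s) ≢ 0
    x-attained s h = proj₁ (bmin-least h₄ (λ k → covered s (suc (h₃ + k))) ≤-refl h)

    h₃<x : ∀ s → h₃ < x s
    h₃<x s = s≤s (m≤m+n h₃ _)

  -- The limit of the construction

  -- What `enter` has checked about the stored pair, which stays fixed until mode 0 returns.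
  Inv : ℕ → Set
  Inv s = m s ≢ 0 → h₁ < kz s × m s ≡ case0 (b₂ (kz s) (kx s)) 1 2 × b₁ (kz s) (kx s) ≢ 0 × h₃ < kx s

  inv-next-0 : ∀ s {m′ c′ p′ kz′ kx′} → Next s m′ c′ p′ kz′ kx′ → m′ ≡ 0 → Inv (suc s)
  inv-next-0 s n m0 m≢0 = contradiction (trans (mode-next s n) m0) m≢0

  inv : ∀ s → Inv s
  inv zero    h = contradiction m-zero h
  inv (suc s) with step s
  ... | idle m0 _ n   = inv-next-0 s n m0
  ... | bump _ _ _ n  = inv-next-0 s n refl
  ... | exit _ _ n    = inv-next-0 s n refl
  ... | enter _ h₁<z _ b≢0 (fields em _ _ ez ex) = λ _ → subst (h₁ <_) (sym ez) h₁<z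
    , trans em (sym (cong₂ (λ y w → case0 (b₂ y w) 1 2) ez ex)) , (λ e → b≢0 (trans (sym (cong₂ b₁ ez ex)) e))
    , subst (h₃ <_) (sym ex) (h₃<x s)
  ... | hold m≢0 _ (fields em _ _ ez ex) = λ _ → let a , b , d , e = inv s m≢0 in subst (h₁ <_) (sym ez) a
    , trans em (trans b (sym (cong₂ (λ y w → case0 (b₂ y w) 1 2) ez ex))) , (λ e → d (trans (sym (cong₂ b₁ ez ex)) e))
    , subst (h₃ <_) (sym ex) e

  Held : ℕ → ℕ → Set
  Held s u = m u ≡ m s × kz u ≡ kz s × kx u ≡ kx s

  -- Mode 2 has no way out, and mode 1 is left only when x differs from the witness.
  persist : ∀ s → m s ≢ 0 → (m s ≡ 1 → ∀ u → s ≤ u → x u ≡ kx s) → ∀ u → s ≤ u → Held s u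
  persist s m≢0 stable u s≤u =
    proj₂ (≤-iterate (λ u → s ≤ u × Held s u) next-stage s≤u (≤-refl , refl , refl , refl))
    where
    next-stage : ∀ u → s ≤ u × Held s u → s ≤ suc u × Held s (suc u)
    next-stage u (s≤u , em , ez , ex) with step u
    ... | idle m0 _ _       = contradiction (trans (sym em) m0) m≢0
    ... | bump m0 _ _ _     = contradiction (trans (sym em) m0) m≢0
    ... | enter m0 _ _ _ _  = contradiction (trans (sym em) m0) m≢0
    ... | exit m1 x≢ _      = contradiction (trans (stable (trans (sym em) m1) u s≤u) (sym ex)) x≢
    ... | hold _ _ (fields em′ _ _ ez′ ex′) = m≤n⇒m≤1+n s≤u , trans em′ em , trans ez′ ez , trans ex′ ex

  -- The value of φ_j may stem from any stage that announces one, so soundness is required of all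
  -- stages. Agreement from t on ensures that nothing of φ_w is missed.
  copy-same : ∀ {j w} G → Realises φ j G → (∀ q r {v} → G q r ≡ suc v → ∃ λ s → T s w q ≡ suc v) →
              (∃ λ t → ∀ q r → t ≤ r → G q r ≡ T r w q) → SameFn φ j φ w
  copy-same {j} {w} G (from , to) sound (t , copies) q v = forth , back
    where
    forth : Eval φ (j ∷ q ∷ []) v → Eval φ (w ∷ q ∷ []) v
    forth e = let r , h = from q v e ; s , h′ = sound q r h in T-sound s w q h′
    back : Eval φ (w ∷ q ∷ []) v → Eval φ (j ∷ q ∷ []) v
    back e = let s , done = T-complete w q e
                 u = t ⊔ s
                 Tu = done u (m≤n⊔m t s)
                 r , v′ , h , e′ = to q u (≡suc⇒≢0 (trans (copies q u (m≤m⊔n t s)) Tu))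
             in subst (Eval φ (j ∷ q ∷ [])) (T-unique (proj₂ (sound q r h)) Tu) e′

  module Limit
    (kill  : ∃ λ j → j ≤ h₁ × Realises φ j Kill)
    (grow  : ∀ k → k ≤ suc h₁ → ∃ λ j → j ≤ h₂ × Realises φ j (Grow k))
    (copy  : ∀ y → y ≤ h₂ → ∃ λ j → j ≤ h₃ × Realises φ j (Copy y))
    (final : ∃ λ j → j ≤ h₃ × Realises φ j Final)
    (const : ∀ i → i ≤ suc h₃ → ∃ λ j → j ≤ h₄ × Realises φ j (λ _ _ → suc i))
    where

    const-at-0 : ∀ i → i ≤ suc h₃ → ∃ λ j → j ≤ h₄ × Eval φ (j ∷ 0 ∷ []) i
    const-at-0 i i≤ with const i i≤
    ... | j , j≤ , _ , to with to 0 0 suc≢0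
    ...   | _ , _ , refl , e = j , j≤ , e

    module _ (t X : ℕ) (x-stable : ∀ s → t ≤ s → x s ≡ X) where

      x-covers : ∃ λ s → t ≤ s × covered s X ≢ 0
      x-covers with ev-× (t , λ _ le → le) (ev-∀< (suc (suc h₃)) λ i i< → reach i (≤-pred i<))
        where
        reach : ∀ i → i ≤ suc h₃ → Eventually (λ s → ∃ λ j → j ≤ h₄ × T s j 0 ≡ suc i)
        reach i i≤ = let j , j≤ , e = const-at-0 i i≤ in ev-map (λ _ h → j , j≤ , h) (T-complete j 0 e)
      ... | s , ok = s , t≤s , subst (λ n → covered s n ≢ 0) (x-stable s t≤s) (x-attained s
                        (covered-intro s (suc (h₃ + h₄)) λ i i≤ → let j , j≤ , h = proj₂ (ok s ≤-refl) i (s≤s i≤)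
                           in j , ≤-trans j≤ (m≤n⇒m≤1+n (m≤n+m h₄ h₃)) , h))
        where t≤s = proj₁ (ok s ≤-refl)

      -- Some value i is missing among the indices below X, so φ_X(0) = i. If φ_j were equal for
      -- some j < X, then j would supply i at a later stage u, and the indices below X would cover
      -- everything at u.
      x-minimal : MIN φ X
      x-minimal j j<X same with x-covers
      ... | s , t≤s , cov = uncovered (pred X) (suc-pred-X)
        where
        suc-pred-X : suc (pred X) ≡ X
        suc-pred-X = sym (≢0⇒≡suc λ X≡0 → contradiction (subst (j <_) X≡0 j<X) λ ())
        uncovered : ∀ n → suc n ≡ X → ⊥
        uncovered n eq with covered-≡0 s n (not-covered-below s (trans eq (sym (x-stable s t≤s))))
        ... | i , i≤ , miss = contradiction (not-covered-below u (trans eq (sym (x-stable u (≤-trans t≤s s≤u)))))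
                                            (covered-intro u n everything)
          where
          below : ∀ {k} → k ≤ X → k ≢ X → k ≤ n
          below k≤X k≢X = ≤-pred (subst (_ <_) (sym eq) (≤∧≢⇒< k≤X k≢X))
          Xi : T s X 0 ≡ suc i
          Xi with covered-elim s X cov i i≤
          ... | k , k≤X , e with k ≟ X
          ...   | yes refl = e
          ...   | no  k≢X  = contradiction e (miss k (below k≤X k≢X))
          converges = T-complete j 0 (proj₂ (same 0 i) (T-sound s X 0 Xi))
          u = s ⊔ proj₁ converges
          s≤u = m≤m⊔n s (proj₁ converges)
          Tj = proj₂ converges u (m≤n⊔m s (proj₁ converges))
          everything : ∀ i′ → i′ ≤ suc h₃ → ∃ λ k → k ≤ n × T u k 0 ≡ suc i′
          everything i′ i′≤ with covered-elim s X cov i′ i′≤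
          ... | k , k≤X , e with k ≟ X
          ...   | no  k≢X  = k , below k≤X k≢X , T-mono k 0 e s≤u
          ...   | yes refl = j , below (<⇒≤ j<X) (<⇒≢ j<X) , trans Tj (trans (sym Xi) e)

      -- Once x has settled, the attack lasts for ever. Then kz ∉ MIN, while kx ∈ MIN in mode 1 and
      -- kx ∉ MIN in mode 2: just the combination that the vector excludes.
      no-attack : ∀ s → t ≤ s → m s ≢ 0 → (m s ≡ 1 → kx s ≡ X) → ⊥
      no-attack s t≤s m≢0 kx≡ = decide (agree (kz s) (kx s))
        where
        invariant = inv s m≢0
        b₁≢0 = proj₁ (proj₂ (proj₂ invariant))
        m≡ = proj₁ (proj₂ invariant)
        held : ∀ u → s ≤ u → Held s u
        held = persist s m≢0 λ m1 u s≤u → trans (x-stable u (≤-trans t≤s s≤u)) (sym (kx≡ m1))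
        killed : ∀ q r → s ≤ r → Kill q r ≡ T r (kz s) q
        killed q r s≤r with held r s≤r
        ... | em , ez , _ = trans (K-1 r (λ e → m≢0 (trans (sym em) e))) (cong (λ y → T r y q) ez)
        kz-dead : ¬ MIN φ (kz s)
        kz-dead = dead (≤-<-trans (proj₁ (proj₂ kill)) (proj₁ invariant))
          (copy-same Kill (proj₂ (proj₂ kill))
            -- Announcements made before s persist by `Kill-mono`, and at the later of the two
            -- stages K is already the copy.
            (λ q r h → s ⊔ r , trans (sym (killed q _ (m≤m⊔n s r))) (Kill-mono q (m≤n⊔m s r) h)) (s , killed))
        kx-dead : b₂ (kz s) (kx s) ≢ 0 → ¬ MIN φ (kx s)
        kx-dead b₂≢0 = dead (≤-<-trans (proj₁ (proj₂ final)) (proj₂ (proj₂ (proj₂ invariant))))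
          (copy-same Final (proj₂ (proj₂ final)) (λ q r h → r , sound q r h) (s , copies))
          where
          m2 : m s ≡ 2
          m2 = trans m≡ (case0-≢0 b₂≢0)
          copies : ∀ q r → s ≤ r → Final q r ≡ T r (kx s) q
          copies q r s≤r with held r s≤r
          ... | em , _ , ex = trans (case0-≢0 (≡suc⇒≢0 (cong pred (trans em m2)))) (cong (λ w → T r w q) ex)
          sound : ∀ q r {v} → Final q r ≡ suc v → T r (kx s) q ≡ suc v
          sound q r h with case0-suc {pred (m r)} h
          ... | pm , h′ with ≤-total s r
          ...   | inj₁ s≤r = trans (cong (λ w → T r w q) (sym (proj₂ (proj₂ (held r s≤r))))) h′
          -- Mode 2 already holds at r and is permanent, so the witness at r is the one at s.
          ...   | inj₂ r≤s = trans (cong (λ w → T r w q) (proj₂ (proj₂ (persist r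
                    (λ e → pm (cong pred e)) (λ e → contradiction (cong pred e) pm) s r≤s)))) h′
        decide : AgreesWith (MIN φ) (kz s) (b₁ (kz s) (kx s)) ⊎ AgreesWith (MIN φ) (kx s) (b₂ (kz s) (kx s)) → ⊥
        decide (inj₁ (inj₁ (_ , min)))  = kz-dead min
        decide (inj₁ (inj₂ (b≡0 , _)))  = b₁≢0 b≡0
        decide (inj₂ (inj₁ (b≡1 , min))) = kx-dead (≡suc⇒≢0 b≡1) min
        decide (inj₂ (inj₂ (b≡0 , ¬min))) = ¬min (subst (MIN φ) (sym (kx≡ (trans m≡ (case0-≡0 b≡0)))) x-minimal)

    module Waiting (t X : ℕ) (x-stable : ∀ s → t ≤ s → x s ≡ X)
                   (m-zero : ∀ s → t ≤ s → m s ≡ 0) (c-stable : ∀ s → t ≤ s → c s ≡ c t) where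

      level-fixed : ∀ s → t ≤ s → c (suc s) ≢ suc (c s)
      level-fixed s t≤s eq =
        <⇒≢ ≤-refl (trans (c-stable s t≤s) (trans (sym (c-stable (suc s) (m≤n⇒m≤1+n t≤s))) eq))

      fixed : ∀ s → t ≤ s → p s ≡ p t × kz s ≡ kz t
      fixed s t≤s = proj₂ (≤-iterate (λ u → t ≤ u × p u ≡ p t × kz u ≡ kz t) next-stage t≤s (≤-refl , refl , refl))
        where
        next-stage : ∀ u → t ≤ u × p u ≡ p t × kz u ≡ kz t → t ≤ suc u × p (suc u) ≡ p t × kz (suc u) ≡ kz t
        next-stage u (t≤u , ep , ez) with step u
        ... | idle _ _ (fields _ _ ep′ ez′ _) = m≤n⇒m≤1+n t≤u , trans ep′ ep , trans ez′ ez
        ... | bump _ _ _ n = contradiction (level-next u n) (level-fixed u t≤u)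
        ... | enter _ _ _ _ n = contradiction (trans (sym (mode-next u n)) (m-zero (suc u) (m≤n⇒m≤1+n t≤u))) (case0-1-2 _)
        ... | exit m1 _ _ = contradiction (trans (sym (m-zero u t≤u)) m1) λ ()
        ... | hold m≢0 _ _ = contradiction (m-zero u t≤u) m≢0

      A-stable : ∀ s → t ≤ s → ∀ q → Aₛ s q ≡ Aₛ t q
      A-stable s t≤s q with fixed s t≤s | q ≟ p t
      ... | ep , ez | yes refl = trans (cong (Aₛ s) (sym ep)) (trans (A-mark s (m-zero s t≤s))
                                 (trans (cong suc (c-stable s t≤s)) (sym (A-mark t (m-zero t ≤-refl)))))
      ... | ep , ez | no  q≢p  = trans (A-0 s (m-zero s t≤s) (λ e → q≢p (trans e ep)))
                                 (trans (cong₂ (λ r y → T r y q) ep ez) (sym (A-0 t (m-zero t ≤-refl) q≢p)))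

      -- While A is fixed, an index once seen to extend it continues to do so.
      zc-decreasing : ∀ k → zc (t + suc k) ≤ zc (t + k)
      zc-decreasing k = z-antitone (t + suc k) (t + k) λ y e → extends-intro (t + suc k) y λ q _ h →
        T-mono y q (extends-elim (t + k) y (m-zero (t + k) (m≤m+n t k)) e q
                     (trans (A-stable _ (m≤m+n t k) q) (trans (sym (A-stable _ (m≤m+n t (suc k)) q)) h)))
                   (+-monoʳ-≤ t (n≤1+n k))

      module Settled (u : ℕ) (t≤u : t ≤ u) (z-stable : ∀ s → u ≤ s → zc s ≡ zc u) where

        m0 : m u ≡ 0
        m0 = m-zero u t≤u

        -- A has finitely many arguments, so at some stage φ_j is seen to extend it; by then z is no
        -- larger than j, and z has settled at u.
        z-below : ∀ j → j ≤ h₂ → (∀ q {v} → Aₛ u q ≡ suc v → Eval φ (j ∷ q ∷ []) v) → zc u ≤ j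
        z-below j j≤h₂ h with ev-× (u , λ _ le → le) (ev-∀< (suc (p u)) λ q _ → reach q)
          where
          reach : ∀ q → Eventually (λ s → ∀ {v} → Aₛ u q ≡ suc v → T s j q ≡ suc v)
          reach q with Aₛ u q in eq
          ... | zero  = 0 , λ _ _ ()
          ... | suc v = ev-map (λ { _ h refl → h }) (T-complete j q (h q eq))
        ... | s , ok = subst (_≤ j) (z-stable s u≤s) (z-least s j j≤h₂ λ q q≤p e →
          proj₂ (ok s ≤-refl) q (s≤s (subst (q ≤_) (trans (proj₁ (fixed s t≤s)) (sym (proj₁ (fixed u t≤u)))) q≤p))
            (trans (A-stable u t≤u q) (trans (sym (A-stable s t≤s q)) e)))
          where
          u≤s = proj₁ (ok s ≤-refl)
          t≤s = ≤-trans t≤u u≤s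

        -- The `Grow` function of the current level extends A and has an index up to h₂: all its
        -- announcements at arguments of A agree with A at u, by `A-level`.
        z≤h₂ : zc u ≤ h₂
        z≤h₂ with grow (c u) (c-bound u)
        ... | j , j≤h₂ , _ , to = ≤-trans (z-below j j≤h₂ realised) j≤h₂
          where
          at-level : ∀ r {q v} → Grow (c u) q r ≡ suc v → c r ≡ c u × Aₛ r q ≡ suc v
          at-level r {q} h with neq (c r) (c u) ≟ 0
          ... | yes e = neq-≡0 _ _ e , trans (sym (case0-≡0 e)) h
          ... | no  e = contradiction (trans (sym h) (case0-≢0 e)) λ ()
          realised : ∀ q {v} → Aₛ u q ≡ suc v → Eval φ (j ∷ q ∷ []) v
          realised q {v} h with to q u (≡suc⇒≢0 (trans (case0-≡0 (neq-refl (c u))) h))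
          ... | r , w , g , e with at-level r g
          ...   | cr , h′ = subst (Eval φ (j ∷ q ∷ [])) w≡v e
            where
            w≡v : w ≡ v
            w≡v with ≤-total r u
            ... | inj₁ r≤u = suc-injective (trans (sym (A-level q r≤u cr h′)) h)
            ... | inj₂ u≤r = suc-injective (trans (sym h′) (A-level q u≤r (sym cr) h))

        z-minimal : MIN φ (zc u)
        z-minimal j j<z same = contradiction
          (z-below j (≤-trans (<⇒≤ j<z) z≤h₂) λ q h → proj₂ (same q _) (T-sound u _ q (z-extends u m0 z≤h₂ q h)))
          (<⇒≱ j<z)

        -- Mode and level stay fixed, which rules out every step but `idle`; the cause of idling is
        -- not z > h₂.
        b₁≡0 : b₁ (zc u) (x u) ≡ 0
        b₁≡0 with step u
        ... | idle _ (inj₁ h₂<z) _           = contradiction z≤h₂ (<⇒≱ h₂<z)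
        ... | idle _ (inj₂ (_ , _ , b≡0)) _  = b≡0
        ... | bump _ _ _ n = contradiction (level-next u n) (level-fixed u t≤u)
        ... | enter _ _ _ _ n = contradiction (trans (sym (mode-next u n)) (m-zero (suc u) (m≤n⇒m≤1+n t≤u))) (case0-1-2 _)
        ... | exit m1 _ _  = contradiction (trans (sym m0) m1) λ ()
        ... | hold m≢0 _ _ = contradiction m0 m≢0

        module Copied (b₂≢0 : b₂ (zc u) (x u) ≢ 0) where
          acts : any≤ u (act (zc u)) ≢ 0
          acts = any-intro u (act (zc u)) ≤-refl λ e → b₂≢0 (trans (sym (case0-≡0 idle-sum)) e)
            where
            idle-sum : m u + neq (zc u) (zc u) + b₁ (zc u) (x u) ≡ 0
            idle-sum rewrite m0 | neq-refl (zc u) = b₁≡0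
          -- The first acting stage may precede u, and its x may differ from the limit; `Copy` is
          -- committed to this w for ever.
          r₀ = bmin u (act (zc u))
          w = x r₀
          active : m r₀ + neq (zc r₀) (zc u) + b₁ (zc u) w ≡ 0 × b₂ (zc u) w ≢ 0
          active = case0-b-0 acts
          b₁w : b₁ (zc u) w ≡ 0
          b₁w = m+n≡0⇒n≡0 (m r₀ + neq (zc r₀) (zc u)) (proj₁ active)
          b₂w : b₂ (zc u) w ≢ 0
          b₂w = proj₂ active
          w-dead : ¬ MIN φ w
          w-dead = dead (≤-<-trans j≤h₃ (h₃<x r₀)) (copy-same (Copy (zc u)) R (λ q r h → r , sound q r h) (u , copies))
            where
            j≤h₃ = proj₁ (proj₂ (copy (zc u) z≤h₂))
            R = proj₂ (proj₂ (copy (zc u) z≤h₂))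
            first : ∀ r → any≤ r (act (zc u)) ≢ 0 → bmin r (act (zc u)) ≡ r₀
            first r a = bmin-unique r u (act (zc u)) a acts
            sound : ∀ q r {v} → Copy (zc u) q r ≡ suc v → T r w q ≡ suc v
            sound q r h with case0-suc {any≤ r (act (zc u))} h
            ... | a , h′ = trans (cong (λ n → T r (x n) q) (sym (first r a))) h′
            copies : ∀ q r → u ≤ r → Copy (zc u) q r ≡ T r w q
            copies q r u≤r = trans (case0-≢0 a) (cong (λ n → T r (x n) q) (first r a))
              where a = any-intro r (act (zc u)) (≤-trans (bmin-≤ u _) u≤r) acts

        -- As z and the limit of x lie in MIN and b₁ = 0, agreement on this pair forces b₂ = 1. Then
        -- `Copy` has acted for z, and the pair of z ∈ MIN and w ∉ MIN disagrees with its vector (0,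
        -- 1) in both positions.
        impossible : ⊥
        impossible with agree (zc u) (x u)
        ... | inj₁ (inj₁ (b≡1 , _))    = contradiction (trans (sym b₁≡0) b≡1) λ ()
        ... | inj₁ (inj₂ (_ , ¬min))   = ¬min z-minimal
        ... | inj₂ (inj₂ (_ , ¬min))   = ¬min (subst (MIN φ) (sym (x-stable u t≤u)) (x-minimal t X x-stable))
        ... | inj₂ (inj₁ (b≡1 , _)) with agree (zc u) (Copied.w (≡suc⇒≢0 b≡1))
        ...   | inj₁ (inj₁ (b≡1′ , _))  = contradiction (trans (sym (Copied.b₁w (≡suc⇒≢0 b≡1))) b≡1′) λ ()
        ...   | inj₁ (inj₂ (_ , ¬min))  = ¬min z-minimal
        ...   | inj₂ (inj₁ (_ , min))   = Copied.w-dead (≡suc⇒≢0 b≡1) min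
        ...   | inj₂ (inj₂ (b≡0 , _))   = Copied.b₂w (≡suc⇒≢0 b≡1) b≡0

      no-waiting : ⊥
      no-waiting = eventually-constant (λ k → zc (t + k)) zc-decreasing 0 λ (k , _ , const) →
        Settled.impossible (t + k) (m≤m+n t k) λ s t+k≤s →
          let s≡ = m+[n∸m]≡n (≤-trans (m≤m+n t k) t+k≤s) in
          trans (cong zc (sym s≡)) (const (s ∸ t) (+-cancelˡ-≤ t _ _ (≤-trans t+k≤s (≤-reflexive (sym s≡)))))

    -- Three quantities settle in turn: x, the level and, in `no-waiting`, z. The level is bounded
    -- by `c-bound`, so its distance to h₁ + 1 is the decreasing quantity.
    absurd : ⊥
    absurd = eventually-constant x x-mono₁ 0 λ (t , _ , x-const) →
      eventually-constant (λ s → suc h₁ ∸ c s) (λ s → ∸-monoʳ-≤ (suc h₁) (c-mono₁ s)) t λ (u , t≤u , c-const) →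
        finish t (x t) x-const u t≤u λ s u≤s → ∸-cancelˡ-≡ (c-bound s) (c-bound u) (c-const s u≤s)
      where
      finish : ∀ t X → (∀ s → t ≤ s → x s ≡ X) → ∀ u → t ≤ u → (∀ s → u ≤ s → c s ≡ c u) → ⊥
      finish t X x-stable u t≤u c-stable = from-zero (start (m u ≟ 0))
        where
        start : _ → ∃ λ w → u ≤ w × m w ≡ 0
        start (yes m0) = u , ≤-refl , m0
        start (no m≢0) with step u
        ... | idle m0 _ _      = contradiction m0 m≢0
        ... | bump m0 _ _ _    = contradiction m0 m≢0
        ... | enter m0 _ _ _ _ = contradiction m0 m≢0
        -- A mode 1 state with an outdated witness is left at once; any other attack would be
        -- permanent.
        ... | exit _ _ n       = suc u , n≤1+n u , mode-next u n
        ... | hold _ x≡ _      = ⊥-elim (no-attack t X x-stable u t≤u m≢0 λ m1 → trans (sym (x≡ m1)) (x-stable u t≤u))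
        stays : ∀ s → u ≤ s → m s ≡ 0 → m (suc s) ≡ 0
        stays s u≤s m0 with step s
        ... | idle _ _ n   = trans (mode-next s n) m0
        ... | bump _ _ _ n = mode-next s n
        ... | exit m1 _ _  = contradiction (trans (sym m0) m1) λ ()
        ... | hold m≢0 _ _ = contradiction m0 m≢0
        ... | enter _ _ _ _ (fields em _ _ _ ex) = ⊥-elim (no-attack t X x-stable (suc s) (m≤n⇒m≤1+n (≤-trans t≤u u≤s))
                (λ e → case0-1-2 _ (trans (sym em) e)) (λ _ → trans ex (x-stable s (≤-trans t≤u u≤s))))
        from-zero : (∃ λ w → u ≤ w × m w ≡ 0) → ⊥
        from-zero (w , u≤w , mw) = Waiting.no-waiting w X (λ s w≤s → x-stable s (≤-trans t≤u (≤-trans u≤w w≤s)))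
          (λ s w≤s → proj₂ (≤-iterate (λ s → u ≤ s × m s ≡ 0) (λ s (u≤s , e) → m≤n⇒m≤1+n u≤s , stays s u≤s e) w≤s (u≤w , mw)))
          (λ s w≤s → trans (c-stable s (≤-trans u≤w w≤s)) (sym (c-stable w u≤w)))

-- Computability of the construction

Computable₄ : (ℕ → ℕ → ℕ → ℕ → ℕ) → Set
Computable₄ f = Σ (PR 4) λ p → ∀ x y z w → Eval p (x ∷ y ∷ z ∷ w ∷ []) (f x y z w)

to₄ : ∀ {f} (F : Fun 4) → (∀ x y z w → fn F (x ∷ y ∷ z ∷ w ∷ []) ≡ f x y z w) → Computable₄ f
to₄ F h = prog F , λ x y z w → subst (Eval (prog F) _) (h x y z w) (ok F _)

app₄ : ∀ {n f} → Computable₄ f → Fun n → Fun n → Fun n → Fun n → Fun n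
app₄ {f = f} (p , e) X Y Z W = fun (λ xs → f (fn X xs) (fn Y xs) (fn Z xs) (fn W xs))
  (comp p (prog X ∷ prog Y ∷ prog Z ∷ prog W ∷ []))
  (λ xs → ev-comp (ev-∷ (ok X xs) (ev-∷ (ok Y xs) (ev-∷ (ok Z xs) (ev-∷ (ok W xs) ev-[])))) (e _ _ _ _))

mode-c : Computable₁ mode
mode-c = fst-c

level-c : Computable₁ level
level-c = to₁ (app₁ fst-c (app₁ snd-c v0)) (λ _ → refl)

mark-c : Computable₁ mark
mark-c = to₁ (app₁ fst-c (app₁ snd-c (app₁ snd-c v0))) (λ _ → refl)

target-c : Computable₁ target
target-c = to₁ (app₁ fst-c (app₁ snd-c (app₁ snd-c (app₁ snd-c v0)))) (λ _ → refl)

witness-c : Computable₁ witness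
witness-c = to₁ (app₁ snd-c (app₁ snd-c (app₁ snd-c (app₁ snd-c v0)))) (λ _ → refl)

codeF : ∀ {n} → Fun n → Fun n → Fun n → Fun n → Fun n → Fun n
codeF M C P Z X = app₂ pair-c M (app₂ pair-c C (app₂ pair-c P (app₂ pair-c Z X)))

module ConstructionComputable
  (T : ℕ → ℕ → ℕ → ℕ) (T-c : Computable₃ T)
  (b₁ b₂ : ℕ → ℕ → ℕ) (b₁-c : Computable₂ b₁) (b₂-c : Computable₂ b₂)
  (h₁ h₂ h₃ h₄ : ℕ → ℕ)
  (h₁-c : Computable₁ h₁) (h₂-c : Computable₁ h₂) (h₃-c : Computable₁ h₃) (h₄-c : Computable₁ h₄)
  where

  -- The bounds depend on the program a that is fixed by self-reference only later, so computability
  -- is shown uniformly in a.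
  module C (a : ℕ) = Construction T b₁ b₂ (h₁ a) (h₂ a) (h₃ a) (h₄ a)

  opaque
    unfolding Construction.covered

    covered-c : Computable₃ C.covered
    covered-c = to₃ (allF (sucF (app₁ h₃-c v0)) (anyF v3 (app₂ same-c (app₃ T-c v3 v0 zeroF) (sucF v1)))) (λ _ _ _ → refl)

  opaque
    unfolding Construction.x

    x-c : Computable₂ C.x
    x-c = to₂ (sucF (app₂ +-c (app₁ h₃-c v0)
                (bminF (app₁ h₄-c v0) (app₃ covered-c v1 v2 (sucF (app₂ +-c (app₁ h₃-c v1) v0)))))) (λ _ _ → refl)

  opaque
    unfolding Construction.K

    K-c : Computable₄ C.K
    K-c = to₄ (app₃ case0-c (app₁ mode-c v1) (app₃ T-c (app₁ mark-c v1) (app₁ target-c v1) v3)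
                (app₃ T-c v2 (app₁ target-c v1) v3)) (λ _ _ _ _ → refl)

  opaque
    unfolding Construction.A

    A-c : Computable₄ C.A
    A-c = to₄ (app₃ case0-c (app₁ mode-c v1)
                (app₃ case0-c (app₂ neq-c v3 (app₁ mark-c v1)) (sucF (app₁ level-c v1))
                  (app₃ T-c (app₁ mark-c v1) (app₁ target-c v1) v3))
                (app₃ T-c v2 (app₁ target-c v1) v3)) (λ _ _ _ _ → refl)

  opaque
    unfolding Construction.extends

    extends-c : Computable₄ C.extends
    extends-c = to₄ (app₁ not-c (anyF (app₁ mark-c v1)
      (app₃ case0-c (app₄ A-c v1 v2 v3 v0) zeroF (app₂ neq-c (app₃ T-c v3 v4 v0) (app₄ A-c v1 v2 v3 v0))))) (λ _ _ _ _ → refl)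

  opaque
    unfolding Construction.z

    z-c : Computable₃ C.z
    z-c = to₃ (bminF (sucF (app₁ h₂-c v0)) (app₄ extends-c v1 v2 v3 v0)) (λ _ _ _ → refl)

  opaque
    unfolding Construction.next

    next-c : Computable₃ C.next
    next-c = to₃
      (app₃ case0-c (app₁ mode-c S)
        (app₃ case0-c (app₂ ∸-c Z (app₁ h₂-c v0))
          (app₃ case0-c (app₂ ∸-c Z (app₁ h₁-c v0))
            (codeF zeroF (sucF (app₁ level-c S)) (app₁ mark-c S) (app₁ target-c S) (app₁ witness-c S))
            (app₃ case0-c (app₂ b₁-c Z X) S
              (codeF (app₃ case0-c (app₂ b₂-c Z X) (conF 1) (conF 2)) (app₁ level-c S) (app₁ mark-c S) Z X)))
          S)
        (app₃ case0-c (app₁ pred-c (app₁ mode-c S))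
          (app₃ case0-c (app₂ neq-c X (app₁ witness-c S)) S
            (codeF zeroF (app₁ level-c S) (sucF v1) (app₁ target-c S) (app₁ witness-c S)))
          S))
      (λ _ _ _ → refl)
      where
      S Z X : Fun 3
      S = v2
      Z = app₃ z-c v0 v2 v1
      X = app₂ x-c v0 v1

  opaque
    unfolding Construction.state

    state-c : Computable₂ C.state
    state-c = to₂ (app (recF (codeF zeroF zeroF zeroF zeroF zeroF) (app₃ next-c v2 v0 v1)) (v1 ∷ v0 ∷ [])) (λ _ _ → refl)

  act-c : Computable₃ C.act
  act-c = to₃
    (app₃ case0-c
      (app₂ +-c (app₂ +-c (app₁ mode-c S) (app₂ neq-c (app₃ z-c v0 S v2) v1)) (app₂ b₁-c v1 X))
      (app₂ b₂-c v1 X) zeroF)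
    (λ _ _ _ → refl)
    where
    S X : Fun 3
    S = app₂ state-c v0 v2
    X = app₂ x-c v0 v2

  Kill-c : Computable₃ C.Kill
  Kill-c = to₃ (app₄ K-c v0 (app₂ state-c v0 v2) v2 v1) (λ _ _ _ → refl)

  Grow-c : Computable₄ C.Grow
  Grow-c = to₄ (app₃ case0-c (app₂ neq-c (app₁ level-c S) v1) (app₄ A-c v0 S v3 v2) zeroF) (λ _ _ _ _ → refl)
    where
    S : Fun 4
    S = app₂ state-c v0 v3

  Copy-c : Computable₄ C.Copy
  Copy-c = to₄ (app₃ case0-c (anyF v3 acts) zeroF (app₃ T-c v3 (app₂ x-c v0 (bminF v3 acts)) v2)) (λ _ _ _ _ → refl)
    where
    acts : Fun 5
    acts = app₃ act-c v1 v2 v0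

  Final-c : Computable₃ C.Final
  Final-c = to₃ (app₃ case0-c (app₁ pred-c (app₁ mode-c S)) zeroF (app₃ T-c v2 (app₁ witness-c S) v1)) (λ _ _ _ → refl)
    where
    S : Fun 3
    S = app₂ state-c v0 v2

-- Searching and self-reference

EvalVec-functional : ∀ {m n} (ps : Vec (PR n) m) {xs ys zs} → EvalVec ps xs ys → EvalVec ps xs zs → ys ≡ zs
EvalVec-functional []       ev-[]       ev-[]         = refl
EvalVec-functional (p ∷ ps) (ev-∷ e es) (ev-∷ e′ es′) = cong₂ _∷_ (Eval-functional p _ e e′) (EvalVec-functional ps es es′)

comp-elim : ∀ {m n} (f : PR m) (Gs : Vec (Fun n) m) xs {v} → Eval (comp f (progs Gs)) xs v → Eval f (map (λ G → fn G xs) Gs) v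
comp-elim f Gs xs (ev-comp es e) = subst (λ ys → Eval f ys _) (EvalVec-functional (progs Gs) es (oks Gs xs)) e

comp-intro : ∀ {m n} (f : PR m) (Gs : Vec (Fun n) m) xs {v} → Eval f (map (λ G → fn G xs) Gs) v → Eval (comp f (progs Gs)) xs v
comp-intro f Gs xs e = ev-comp (oks Gs xs) e

module Search (G : ℕ → ℕ → ℕ → ℕ) (G-c : Computable₃ G) where

  stop value : Fun 3
  stop  = app₁ not-c (app₃ G-c v0 v1 v2)
  value = app₁ pred-c (app₃ G-c v0 v1 v2)

  search : Numbering
  search = comp (prog value) (mu (prog stop) ∷ proj zero ∷ proj (suc zero) ∷ [])

  search-sound : ∀ e q {v} → Eval search (e ∷ q ∷ []) v → ∃ λ r → G r e q ≡ suc v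
  search-sound e q (ev-comp (ev-∷ {y = r} (ev-mu found _) (ev-∷ ev-proj (ev-∷ ev-proj ev-[]))) e′) =
    r , trans (≢0⇒≡suc (not-≡0⁻¹ (Eval-functional (prog stop) _ (ok stop (r ∷ e ∷ q ∷ [])) found)))
              (cong suc (Eval-functional (prog value) _ (ok value (r ∷ e ∷ q ∷ [])) e′))

  -- The search reports the least announcing stage, whose value may differ from the one at r. This
  -- is why `Realises` speaks of another stage r′.
  search-complete : ∀ e q r → G r e q ≢ 0 → ∃ λ r′ → ∃ λ v → G r′ e q ≡ suc v × Eval search (e ∷ q ∷ []) v
  search-complete e q r h = r₀ , pred (G r₀ e q) , ≢0⇒≡suc G≢0 ,
    ev-comp (ev-∷ (ev-mu (subst (Eval (prog stop) _) (not-≡0 G≢0) (ok stop (r₀ ∷ e ∷ q ∷ [])))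
                         (λ r′ r′<r₀ → 0 , subst (Eval (prog stop) _) (cong not (bmin-< r _ r′<r₀)) (ok stop (r′ ∷ e ∷ q ∷ []))))
                  (ev-∷ ev-proj (ev-∷ ev-proj ev-[])))
            (ok value (r₀ ∷ e ∷ q ∷ []))
    where
    r₀ = bmin r (λ r → G r e q)
    G≢0 : G r₀ e q ≢ 0
    G≢0 = any-intro r (λ r → G r e q) ≤-refl h

-- Monotone stage approximations of φ

module Approximation (φ : Numbering) where

  apφ : Fun 3
  apφ = cast (proj₁ (apF φ))
    (λ { (r ∷ j ∷ q ∷ []) → ap φ r (j ∷ q ∷ []) })
    (λ { (r ∷ j ∷ q ∷ []) → proj₂ (apF φ) r (j ∷ q ∷ []) })

  -- Fuels up to q are discarded, so that at stage s only arguments below s have values; this gives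
  -- `T-fresh`.
  try : ℕ → ℕ → ℕ → ℕ
  try j q r = case0 (r ∸ q) 0 (ap φ r (j ∷ q ∷ []))

  opaque
    -- `any≤` yields the value of `try` at the least successful fuel, which makes T monotone in s
    -- whatever `ap` does at larger fuels.
    T : ℕ → ℕ → ℕ → ℕ
    T s j q = any≤ s (try j q)

    T-c : Computable₃ T
    T-c = to₃ (anyF v0 (app₃ case0-c (app₂ ∸-c v0 v3) zeroF (app apφ (v0 ∷ v2 ∷ v3 ∷ [])))) (λ _ _ _ → refl)

    T-mono : ∀ {s s′} j q {v} → T s j q ≡ suc v → s ≤ s′ → T s′ j q ≡ suc v
    T-mono {s} {s′} j q h s≤s′ = trans (cong (try j q) (bmin-unique s′ s (try j q) later now)) h
      where
      now : try j q (bmin s (try j q)) ≢ 0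
      now = ≡suc⇒≢0 h
      later : try j q (bmin s′ (try j q)) ≢ 0
      later = any-intro s′ (try j q) (≤-trans (bmin-≤ s (try j q)) s≤s′) now

    T-fresh : ∀ s j q → s ≤ q → T s j q ≡ 0
    T-fresh s j q s≤q = case0-≡0 (m≤n⇒m∸n≡0 (≤-trans (bmin-≤ s (try j q)) s≤q))

    T-sound : ∀ s j q {v} → T s j q ≡ suc v → Eval φ (j ∷ q ∷ []) v
    T-sound s j q h = ap-sound φ _ _ (proj₂ (case0-suc {bmin s (try j q) ∸ q} h))

    T-complete : ∀ j q {v} → Eval φ (j ∷ q ∷ []) v → Eventually (λ s → T s j q ≡ suc v)
    T-complete j q {v} e with ap-complete φ (j ∷ q ∷ []) e
    ... | t , done = suc (q + t) , λ s le → converged s le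
      where
      converged : ∀ s → suc (q + t) ≤ s → T s j q ≡ suc v
      converged s le = trans (≢0⇒≡suc found) (cong suc (Eval-functional φ _ (T-sound s j q (≢0⇒≡suc found)) e))
        where
        found : T s j q ≢ 0
        found = any-intro s (try j q) {s} ≤-refl (≡suc⇒≢0 (trans
          (case0-≢0 (m>n⇒m∸n≢0 (≤-trans (s≤s (m≤m+n q t)) le)))
          (done s (≤-trans (≤-trans (m≤n+m t q) (n≤1+n _)) le))))

Realises-cong : ∀ {φ j G H} → (∀ q r → G q r ≡ H q r) → Realises φ j G → Realises φ j H
Realises-cong eq (from , to) =
  (λ q v e → let r , h = from q v e in r , trans (sym (eq q r)) h) ,
  (λ q r h → let r′ , v , g , e = to q r (λ e → h (trans (sym (eq q r)) e)) in r′ , v , trans (sym (eq q r′)) g , e)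

module SelfReference (φ : Numbering) (bounded : ComputablyBounded φ) where

  -- Indices of ψ are pairs whose first component is a program, which makes self-reference immediate.
  ψ : Numbering
  ψ = comp φ (progs (app₁ fst-c v0 ∷ app₂ pair-c v0 v1 ∷ []))

  opaque
    F : ℕ → ℕ
    F = proj₁ (bounded ψ)

    F-c : Computable₁ F
    F-c = proj₁ (proj₂ (bounded ψ))

    F-bounds : ∀ e → ∃ λ j → j ≤ F e × SameFn φ j ψ e
    F-bounds = proj₂ (proj₂ (bounded ψ))

    -- Choose a with φ_a(⟨e,q⟩) = P(e,q). Then ψ at ⟨a,b⟩ runs φ_a on ⟨⟨a,b⟩,q⟩, that is, P on its
    -- own index.
    recursion : ∀ P → ∃ λ a → ∀ b → SameFn ψ (pair a b) P (pair a b)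
    recursion P = a , λ b q v → forth b q v , back b q v
      where
      unpaired : Vec (Fun 2) 2
      unpaired = app₁ fst-c v1 ∷ app₁ snd-c v1 ∷ []
      program : ∃ λ a → SameFn φ a (comp P (progs unpaired)) 0
      -- The numbering to which `bounded` is applied ignores its index, so the entry 0 serves as
      -- well as any other.
      program = let a , _ , same = proj₂ (proj₂ (bounded (comp P (progs unpaired)))) 0 in a , same
      a : ℕ
      a = proj₁ program
      runs-P : SameFn φ a (comp P (progs unpaired)) 0
      runs-P = proj₂ program
      paired : Vec (Fun 2) 2
      paired = app₁ fst-c v0 ∷ app₂ pair-c v0 v1 ∷ []
      forth : ∀ b q v → Eval ψ (pair a b ∷ q ∷ []) v → Eval P (pair a b ∷ q ∷ []) v
      forth b q v e = subst₂ (λ x y → Eval P (x ∷ y ∷ []) v) (fst-pair (pair a b) q) (snd-pair (pair a b) q)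
        (comp-elim P unpaired (0 ∷ pair (pair a b) q ∷ [])
          (proj₁ (runs-P (pair (pair a b) q) v)
            (subst (λ x → Eval φ (x ∷ pair (pair a b) q ∷ []) v) (fst-pair a b)
              (comp-elim φ paired (pair a b ∷ q ∷ []) e))))
      back : ∀ b q v → Eval P (pair a b ∷ q ∷ []) v → Eval ψ (pair a b ∷ q ∷ []) v
      back b q v e = comp-intro φ paired (pair a b ∷ q ∷ [])
        (subst (λ x → Eval φ (x ∷ pair (pair a b) q ∷ []) v) (sym (fst-pair a b))
          (proj₂ (runs-P (pair (pair a b) q) v)
            (comp-intro P unpaired (0 ∷ pair (pair a b) q ∷ [])
              (subst₂ (λ x y → Eval P (x ∷ y ∷ []) v) (sym (fst-pair (pair a b) q)) (sym (snd-pair (pair a b) q)) e))))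

-- The self-referential functions and the bounds on their indices

module Diagonal (φ : Numbering) (bounded : ComputablyBounded φ)
                (b₁ b₂ : ℕ → ℕ → ℕ) (b₁-c : Computable₂ b₁) (b₂-c : Computable₂ b₂) where

  open Approximation φ public
  open SelfReference φ bounded

  index : ℕ → ℕ → ℕ → ℕ
  index a k i = pair a (pair k i)

  Findex : ∀ {n} → Fun n → ℕ → Fun n → Fun n
  Findex A k I = app₁ F-c (app₂ pair-c A (app₂ pair-c (conF k) I))

  -- The sums are common upper bounds for finitely many values of F. Each bound uses only a and
  -- earlier bounds, so all are available before the construction starts.
  h₁ h₂ h₃ h₄ : ℕ → ℕ
  h₁ a = F (index a 0 0)
  h₂ a = sum≤ (suc (h₁ a)) (λ i → F (index a 1 i))
  h₃ a = sum≤ (h₂ a) (λ i → F (index a 2 i)) + F (index a 3 0)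
  h₄ a = sum≤ (suc (h₃ a)) (λ i → F (index a 4 i))

  opaque
    h₁-c : Computable₁ h₁
    h₁-c = to₁ (Findex v0 0 zeroF) (λ _ → refl)

    h₂-c : Computable₁ h₂
    h₂-c = to₁ (sumF (sucF (app₁ h₁-c v0)) (Findex v1 1 v0)) (λ _ → refl)

    h₃-c : Computable₁ h₃
    h₃-c = to₁ (app₂ +-c (sumF (app₁ h₂-c v0) (Findex v1 2 v0)) (Findex v0 3 zeroF)) (λ _ → refl)

    h₄-c : Computable₁ h₄
    h₄-c = to₁ (sumF (sucF (app₁ h₃-c v0)) (Findex v1 4 v0)) (λ _ → refl)

  open ConstructionComputable T T-c b₁ b₂ b₁-c b₂-c h₁ h₂ h₃ h₄ h₁-c h₂-c h₃-c h₄-c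

  dispatch : ℕ → ℕ → ℕ → ℕ → ℕ → ℕ
  dispatch k i a q r = case0 k (C.Kill a q r) (case0 (k ∸ 1) (C.Grow a i q r)
    (case0 (k ∸ 2) (C.Copy a i q r) (case0 (k ∸ 3) (C.Final a q r) (suc i))))

  dispatch-cong : ∀ {k k′ i i′ a a′ q r} → k ≡ k′ → i ≡ i′ → a ≡ a′ → dispatch k i a q r ≡ dispatch k′ i′ a′ q r
  dispatch-cong refl refl refl = refl

  G : ℕ → ℕ → ℕ → ℕ
  G r e q = dispatch (fst (snd e)) (snd (snd e)) (fst e) q r

  opaque
    G-c : Computable₃ G
    G-c = to₃
      (app₃ case0-c k (app₃ Kill-c a v2 v0) (app₃ case0-c (app₂ ∸-c k (conF 1)) (app₄ Grow-c a i v2 v0)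
        (app₃ case0-c (app₂ ∸-c k (conF 2)) (app₄ Copy-c a i v2 v0)
          (app₃ case0-c (app₂ ∸-c k (conF 3)) (app₃ Final-c a v2 v0) (sucF i)))))
      (λ _ _ _ → refl)
      where
      k i a : Fun 3
      k = app₁ fst-c (app₁ snd-c v1)
      i = app₁ snd-c (app₁ snd-c v1)
      a = app₁ fst-c v1

  open Search G G-c

  opaque
    a : ℕ
    a = proj₁ (recursion search)

    a-searches : ∀ b → SameFn ψ (pair a b) search (pair a b)
    a-searches = proj₂ (recursion search)

  -- By the choice of a, ψ at ⟨a,⟨k,i⟩⟩ is the search for an announcement of `dispatch k i a`, and F
  -- bounds one of its φ-indices.
  realise : ∀ k i → ∃ λ j → j ≤ F (index a k i) × Realises φ j (dispatch k i a)
  realise k i with F-bounds (index a k i)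
  ... | j , j≤ , same = j , j≤ , Realises-cong unindex
    ( (λ q v e → search-sound (index a k i) q (proj₁ (a-searches (pair k i) q v) (proj₁ (same q v) e)))
    , (λ q r h → let r′ , v , g , e = search-complete (index a k i) q r h in
                 r′ , v , g , proj₂ (same q v) (proj₂ (a-searches (pair k i) q v) e)))
    where
    unindex : ∀ q r → G r (index a k i) q ≡ dispatch k i a q r
    unindex q r = dispatch-cong (trans (cong fst (snd-pair a _)) (fst-pair k i))
                                (trans (cong snd (snd-pair a _)) (snd-pair k i)) (fst-pair a _)

  kill : ∃ λ j → j ≤ h₁ a × Realises φ j (C.Kill a)
  kill = realise 0 0

  grow : ∀ i → i ≤ suc (h₁ a) → ∃ λ j → j ≤ h₂ a × Realises φ j (C.Grow a i)
  grow i i≤ = let j , j≤ , R = realise 1 i in j , ≤-trans j≤ (≤-sum (suc (h₁ a)) (λ i → F (index a 1 i)) i≤) , R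

  copy : ∀ i → i ≤ h₂ a → ∃ λ j → j ≤ h₃ a × Realises φ j (C.Copy a i)
  copy i i≤ = let j , j≤ , R = realise 2 i in
    j , ≤-trans j≤ (≤-trans (≤-sum (h₂ a) (λ i → F (index a 2 i)) i≤) (m≤m+n _ _)) , R

  final : ∃ λ j → j ≤ h₃ a × Realises φ j (C.Final a)
  final = let j , j≤ , R = realise 3 0 in j , ≤-trans j≤ (m≤n+m _ _) , R

  const : ∀ i → i ≤ suc (h₃ a) → ∃ λ j → j ≤ h₄ a × Realises φ j (λ _ _ → suc i)
  const i i≤ = let j , j≤ , R = realise 4 i in j , ≤-trans j≤ (≤-sum (suc (h₃ a)) (λ i → F (index a 4 i)) i≤) , R

theorem5p4 : (φ : Numbering) → ComputablyBounded φ → ¬ OneTwoRecursive (MIN φ)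
theorem5p4 φ bounded (b₁ , b₂ , b₁-c , b₂-c , _ , agree) = Analysis.Limit.absurd
  φ T T-mono T-fresh T-sound T-complete b₁ b₂ agree (h₁ a) (h₂ a) (h₃ a) (h₄ a)
  kill grow copy final const
  where
  open Diagonal φ bounded b₁ b₂ b₁-c b₂-c
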